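{- Let $L=kI-A$ be the Laplacian matrix of the skew-lines graph $\Gamma$ on the $2$-dimensional subspaces of $V=\mathbb F_q^n$, where $n\ge4$, $q=p^t$, and $A$ is the adjacency matrix of $\Gamma$. For $0\le i<4t$ the multiplicity of $p^i$ as an elementary divisor of $L$ equals the multiplicity of $p^i$ as an elementary divisor of $A$, and for $i\ge4t$ the multiplicity of $p^i$ as an elementary divisor of $L$ is $0$.
   Context: Let $p$ be a prime, $q=p^t$ with $t\ge1$, $n\ge4$, and $V$ an $n$-dimensional vector space over $\mathbb F_q$. The skew-lines graph $\Gamma$ has as vertices the $2$-dimensional subspaces of $V$, two being adjacent when their intersection is $\{0\}$. It is regular of valency $k=q^4\left[\begin{smallmatrix}n-2\\ 2\end{smallmatrix}\right]_q$, where $\left[\begin{smallmatrix}m\\ j\end{smallmatrix}\right]_q$ is the number of $j$-dimensional subspaces of $\mathbb F_q^m$. The multiplicity of $p^i$ as an elementary divisor of an integer matrix is the number of nonzero diagonal entries of its Smith normal form whose $p$-adic valuation is exactly $i$. -}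

module Defs where

open import Algebra.Bundles using (CommutativeRing)
open import Data.Bool.Base using (if_then_else_)
open import Data.Fin.Base as Fin using (Fin; finToFun; funToFin)
import Data.Fin.Properties as Fin
open import Data.Integer.Base as ℤ using (ℤ; 0ℤ; 1ℤ)
import Data.Integer.Properties as ℤ
open import Data.List.Base using (List; []; _∷_; allFin; deduplicate; filter; length; lookup; mapMaybe)
open import Data.List.Membership.Propositional.Properties using (∈-allFin) renaming (∈-lookup to ∈-lookup≡)
open import Data.List.Relation.Unary.All as All using ()
open import Data.List.Relation.Unary.AllPairs using ([]; _∷_)
open import Data.List.Relation.Unary.Any as Any using (Any; here; there; index)
open import Data.List.Relation.Unary.Any.Properties using (lookup-index; map⁺; mapMaybe⁺)
import Data.List.Relation.Unary.Enumerates.Setoid as Enumerates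
import Data.List.Relation.Unary.Enumerates.Setoid.Properties as EnumeratesProperties
import Data.List.Relation.Unary.Unique.DecSetoid.Properties as UniqueProperties
import Data.List.Relation.Unary.Unique.Setoid as Unique
open import Data.Maybe.Base using (Maybe; just; nothing)
import Data.Maybe.Relation.Unary.Any as Maybe
open import Data.Nat.Base as ℕ using (ℕ; zero; suc)
open import Data.Nat.Divisibility using (_∣_; _∣?_)
import Data.Nat.Properties as ℕ
open import Data.Product.Base using (Σ; ∃; ∃-syntax; _×_; _,_; proj₁; proj₂)
open import Data.Vec.Functional using (Vector)
import Data.Vec.Functional.Relation.Binary.Equality.Setoid as VecEq
open import Function.Base using (_∘_)
open import Function.Bundles using (Inverse)
open import Function.Properties.Inverse using (Inverse⇒Injection)
open import Level using (_⊔_) renaming (suc to lsuc)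
open import Relation.Binary.Bundles using (Setoid; DecSetoid)
open import Relation.Binary.Definitions using (Decidable; _Respects_)
open import Relation.Binary.PropositionalEquality as ≡ using (_≡_; _≢_)
open import Relation.Nullary.Decidable using (Dec; yes; no; does; map′; ¬?; _×-dec_; _→-dec_; via-injection)
open import Relation.Nullary.Negation using (¬_; contradiction)
open import Relation.Unary using (Pred)

record FiniteField c ℓ : Set (lsuc (c ⊔ ℓ)) where
  field
    commutativeRing : CommutativeRing c ℓ

  open CommutativeRing commutativeRing public

  field
    0≉1         : ¬ (0# ≈ 1#)
    invertible  : ∀ x → ¬ (x ≈ 0#) → ∃[ y ] x * y ≈ 1#
    order       : ℕ
    enumeration : Inverse setoid (≡.setoid (Fin order))

module _ {a ℓ} (S : DecSetoid a ℓ) where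
  open DecSetoid S using (_≟_; _≈_; sym; trans; setoid) renaming (Carrier to A)
  open Enumerates setoid using (IsEnumeration)

  lookup-injective : ∀ {xs} → Unique.Unique setoid xs →
                     ∀ i j → lookup xs i ≈ lookup xs j → i ≡ j
  lookup-injective {_ ∷ _}  (_   ∷ _) Fin.zero    Fin.zero    _  = ≡.refl
  lookup-injective {_ ∷ xs} (x∉ ∷ _)  Fin.zero    (Fin.suc j) eq =
    contradiction eq (All.lookup x∉ (∈-lookup≡ j))
  lookup-injective {_ ∷ xs} (x∉ ∷ _)  (Fin.suc i) Fin.zero    eq =
    contradiction (sym eq) (All.lookup x∉ (∈-lookup≡ i))
  lookup-injective {_ ∷ xs} (_ ∷ u)   (Fin.suc i) (Fin.suc j) eq =
    ≡.cong Fin.suc (lookup-injective u i j eq)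

  finite : ∀ {xs} → IsEnumeration xs → ∃[ N ] Inverse setoid (≡.setoid (Fin N))
  finite {xs} _∈xs = length ys , record
    { to        = to
    ; from      = lookup ys
    ; to-cong   = λ {x} {y} x≈y → lookup-injective ys! (to x) (to y)
                    (trans (sym (x≈lookup x)) (trans x≈y (x≈lookup y)))
    ; from-cong = λ { ≡.refl → DecSetoid.refl S }
    ; inverse   = (λ {i} {x} x≈ → lookup-injective ys! (to x) i
                    (trans (sym (x≈lookup x)) x≈))
                , (λ { {x} ≡.refl → sym (x≈lookup x) })
    }
    where
    ys = deduplicate _≟_ xs

    ys! : Unique.Unique setoid ys
    ys! = UniqueProperties.deduplicate-! S xs

    _∈ys : IsEnumeration ys
    _∈ys = EnumeratesProperties.deduplicate⁺ S _∈xs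

    to : A → Fin (length ys)
    to x = index (x ∈ys)

    x≈lookup : ∀ x → x ≈ lookup ys (to x)
    x≈lookup x = lookup-index (x ∈ys)

module LinearAlgebra {c ℓ} (F : FiniteField c ℓ) where
  open FiniteField F
  open VecEq setoid public using (_≋_; ≋-refl; ≋-sym; ≋-trans)
  import Algebra.Properties.Semiring.Sum semiring as Sum

  V : ℕ → Set c
  V n = Vector Carrier n

  0ᵛ : ∀ {n} → V n
  0ᵛ _ = 0#

  infixl 6 _+ᵛ_
  infixr 7 _*ᵛ_

  _+ᵛ_ : ∀ {n} → V n → V n → V n
  (x +ᵛ y) i = x i + y i

  _*ᵛ_ : ∀ {n} → Carrier → V n → V n
  (r *ᵛ x) i = r * x i

  linearCombination : ∀ {n j} → Vector Carrier j → Vector (V n) j → V n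
  linearCombination a b i = Sum.sum (λ s → a s * b s i)

  LinearlyIndependent : ∀ {n j} → Vector (V n) j → Set (c ⊔ ℓ)
  LinearlyIndependent {j = j} b =
    ∀ (a : Vector Carrier j) → linearCombination a b ≋ 0ᵛ → ∀ s → a s ≈ 0#

  record Subspace (n : ℕ) : Set (lsuc (c ⊔ ℓ)) where
    field
      member   : Pred (V n) (c ⊔ ℓ)
      resp     : member Respects _≋_
      0-closed : member 0ᵛ
      +-closed : ∀ {x y} → member x → member y → member (x +ᵛ y)
      *-closed : ∀ r {x} → member x → member (r *ᵛ x)

  infix 4 _∈_ _⊆_

  _∈_ : ∀ {n} → V n → Subspace n → Set (c ⊔ ℓ)
  x ∈ U = Subspace.member U x

  _⊆_ : ∀ {n} → Subspace n → Subspace n → Set (c ⊔ ℓ)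
  U ⊆ W = ∀ x → x ∈ U → x ∈ W

  record Basis {n} (U : Subspace n) (j : ℕ) : Set (c ⊔ ℓ) where
    field
      vector      : Vector (V n) j
      vector∈     : ∀ s → vector s ∈ U
      independent : LinearlyIndependent vector
      spanning    : ∀ x → x ∈ U → ∃[ a ] linearCombination a vector ≋ x

  TrivialIntersection : ∀ {n} → Subspace n → Subspace n → Set (c ⊔ ℓ)
  TrivialIntersection U W = ∀ x → x ∈ U → x ∈ W → x ≋ 0ᵛ

  -- The basis only witnesses the dimension: equality compares the
  -- underlying subspaces and ignores it.
  Grassmannian : ℕ → ℕ → Setoid (lsuc (c ⊔ ℓ)) (c ⊔ ℓ)
  Grassmannian n j = record
    { Carrier       = Σ (Subspace n) (λ U → Basis U j)
    ; _≈_           = λ (U , _) (W , _) → U ⊆ W × W ⊆ U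
    ; isEquivalence = record
      { refl  = (λ _ z → z) , (λ _ z → z)
      ; sym   = λ (f , g) → g , f
      ; trans = λ (f , g) (f′ , g′) →
                  (λ x → f′ x ∘ f x) , (λ x → g x ∘ g′ x)
      }
    }

  infix 4 _≟_ _≋?_

  _≟_ : Decidable _≈_
  _≟_ = via-injection (Inverse⇒Injection enumeration) Fin._≟_

  _≋?_ : ∀ {n} → Decidable (_≋_ {n})
  x ≋? y = Fin.all? (λ i → x i ≟ y i)

  decode : ∀ {n} → Fin (order ℕ.^ n) → V n
  decode k i = Inverse.from enumeration (finToFun k i)

  encode : ∀ {n} → V n → Fin (order ℕ.^ n)
  encode x = funToFin (λ i → Inverse.to enumeration (x i))

  decode-encode : ∀ {n} (x : V n) → decode (encode x) ≋ x
  decode-encode x i = Inverse.inverseʳ enumeration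
    (Fin.finToFun-funToFin (λ s → Inverse.to enumeration (x s)) i)

  module _ {n p} {P : Pred (V n) p} (P-resp : P Respects _≋_)
           (P? : ∀ x → Dec (P x)) where

    abstract
      ∀? : Dec (∀ x → P x)
      ∀? = map′ (λ f x → P-resp (decode-encode x) (f (encode x)))
                (λ f k → f (decode k))
                (Fin.all? (λ k → P? (decode k)))

      ∃? : Dec (∃[ x ] P x)
      ∃? = map′ (λ (k , Pk) → decode k , Pk)
                (λ (x , Px) → encode x , P-resp (≋-sym (decode-encode x)) Px)
                (Fin.any? (λ k → P? (decode k)))

  linearCombination-cong : ∀ {n j} {a a′ : Vector Carrier j} {b b′ : Vector (V n) j} →
                           a ≋ a′ → (∀ s → b s ≋ b′ s) →
                           linearCombination a b ≋ linearCombination a′ b′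
  linearCombination-cong a≋ b≋ i = Sum.sum-cong-≋ (λ s → *-cong (a≋ s) (b≋ s i))

  linearCombination∈ : ∀ {n j} (U : Subspace n) (a : Vector Carrier j) {b : Vector (V n) j} →
                       (∀ s → b s ∈ U) → linearCombination a b ∈ U
  linearCombination∈ {j = zero}  U a b∈ = Subspace.0-closed U
  linearCombination∈ {j = suc j} U a b∈ =
    Subspace.+-closed U (Subspace.*-closed U (a Fin.zero) (b∈ Fin.zero))
                        (linearCombination∈ U (a ∘ Fin.suc) (b∈ ∘ Fin.suc))

  span : ∀ {n j} → Vector (V n) j → Subspace n
  span {j = j} b = record
    { member   = λ x → ∃[ a ] linearCombination a b ≋ x
    ; resp     = λ x≋y (a , a≋) → a , ≋-trans a≋ x≋y
    ; 0-closed = (λ _ → 0#) , λ i → trans (Sum.sum-cong-≋ (λ s → zeroˡ (b s i)))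
                                          (Sum.sum-replicate-zero j)
    ; +-closed = λ (a , a≋) (a′ , a′≋) → (λ s → a s + a′ s) , λ i →
        trans (Sum.sum-cong-≋ (λ s → distribʳ (b s i) (a s) (a′ s)))
        (trans (Sum.∑-distrib-+ (λ s → a s * b s i) (λ s → a′ s * b s i))
               (+-cong (a≋ i) (a′≋ i)))
    ; *-closed = λ r (a , a≋) → (λ s → r * a s) , λ i →
        trans (Sum.sum-cong-≋ (λ s → *-assoc r (a s) (b s i)))
        (trans (sym (Sum.*-distribˡ-sum r (λ s → a s * b s i)))
               (*-congˡ (a≋ i)))
    }

  span⊆ : ∀ {n j} (U : Subspace n) {b : Vector (V n) j} → (∀ s → b s ∈ U) → span b ⊆ U
  span⊆ U b∈ x (a , a≋) = Subspace.resp U a≋ (linearCombination∈ U a b∈)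

  δ : ∀ {j} → Fin j → Vector Carrier j
  δ Fin.zero    Fin.zero    = 1#
  δ Fin.zero    (Fin.suc _) = 0#
  δ (Fin.suc _) Fin.zero    = 0#
  δ (Fin.suc s) (Fin.suc r) = δ s r

  linearCombination-δ : ∀ {n j} (b : Vector (V n) j) s → linearCombination (δ s) b ≋ b s
  linearCombination-δ {j = suc j} b Fin.zero i =
    trans (+-cong (*-identityˡ _)
            (trans (Sum.sum-cong-≋ (λ s → zeroˡ (b (Fin.suc s) i)))
                   (Sum.sum-replicate-zero j)))
          (+-identityʳ _)
  linearCombination-δ {j = suc j} b (Fin.suc s) i =
    trans (+-cong (zeroˡ _) (linearCombination-δ (b ∘ Fin.suc) s i)) (+-identityˡ _)

  spanBasis : ∀ {n j} {b : Vector (V n) j} → LinearlyIndependent b → Basis (span b) j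
  spanBasis {b = b} ind = record
    { vector      = b
    ; vector∈     = λ s → δ s , linearCombination-δ b s
    ; independent = ind
    ; spanning    = λ _ x∈ → x∈
    }

  member? : ∀ {n j} (U : Subspace n) → Basis U j → ∀ x → Dec (x ∈ U)
  member? U B x =
    map′ (span⊆ U vector∈ x) (spanning x)
      (∃? (λ a≋a′ a≋ → ≋-trans (linearCombination-cong (≋-sym a≋a′) (λ _ → ≋-refl)) a≋)
          (λ a → linearCombination a vector ≋? x))
    where open Basis B

  ⊆? : ∀ {n j} (U W : Subspace n) → Basis U j → Basis W j → Dec (U ⊆ W)
  ⊆? U W B C =
    ∀? (λ x≋y f y∈ → Subspace.resp W x≋y (f (Subspace.resp U (≋-sym x≋y) y∈)))
       (λ x → member? U B x →-dec member? W C x)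

  trivialIntersection? : ∀ {n j} (U W : Subspace n) → Basis U j → Basis W j →
                         Dec (TrivialIntersection U W)
  trivialIntersection? U W B C =
    ∀? (λ x≋y f y∈U y∈W → ≋-trans (≋-sym x≋y)
         (f (Subspace.resp U (≋-sym x≋y) y∈U) (Subspace.resp W (≋-sym x≋y) y∈W)))
       (λ x → member? U B x →-dec member? W C x →-dec (x ≋? 0ᵛ))

  independent? : ∀ {n j} (b : Vector (V n) j) → Dec (LinearlyIndependent b)
  independent? b =
    ∀? (λ a≋a′ f a′≋0 s → trans (sym (a≋a′ s))
         (f (≋-trans (linearCombination-cong a≋a′ (λ _ → ≋-refl)) a′≋0) s))
       (λ a → (linearCombination a b ≋? 0ᵛ) →-dec Fin.all? (λ s → a s ≟ 0#))

  grassmannianDec : ℕ → ℕ → DecSetoid (lsuc (c ⊔ ℓ)) (c ⊔ ℓ)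
  grassmannianDec n j = record
    { isDecEquivalence = record
      { isEquivalence = Setoid.isEquivalence (Grassmannian n j)
      ; _≟_           = λ (U , B) (W , C) → ⊆? U W B C ×-dec ⊆? W U C B
      }
    }

  -- Every j-dimensional subspace is spanned by one of the finitely many
  -- j-tuples of vectors, so the Grassmannian is finite.

  tuple : ∀ {n j} → Fin ((order ℕ.^ n) ℕ.^ j) → Vector (V n) j
  tuple k s = decode (finToFun k s)

  spanWhenIndependent : ∀ {n j} (b : Vector (V n) j) → Dec (LinearlyIndependent b) →
                        Maybe (Setoid.Carrier (Grassmannian n j))
  spanWhenIndependent b (yes ind) = just (span b , spanBasis ind)
  spanWhenIndependent b (no _)    = nothing

  tupleSpan : ∀ {n j} → Fin ((order ℕ.^ n) ℕ.^ j) → Maybe (Setoid.Carrier (Grassmannian n j))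
  tupleSpan k = spanWhenIndependent (tuple k) (independent? (tuple k))

  grassmannianEnumeration : ∀ n j →
    Enumerates.IsEnumeration (Grassmannian n j) (mapMaybe tupleSpan (allFin _))
  grassmannianEnumeration n j (U , B) =
    mapMaybe⁺ tupleSpan (allFin _)
      (map⁺ (Any.map (λ { ≡.refl → found (independent? (tuple k)) }) (∈-allFin k)))
    where
    open Basis B

    k : Fin ((order ℕ.^ n) ℕ.^ j)
    k = funToFin (λ s → encode (vector s))

    tuple≋ : ∀ s → tuple k s ≋ vector s
    tuple≋ s rewrite Fin.finToFun-funToFin (λ s → encode (vector s)) s =
      decode-encode (vector s)

    ind : LinearlyIndependent (tuple k)
    ind a a≋0 = independent a
      (≋-trans (linearCombination-cong (λ _ → refl) (λ s → ≋-sym (tuple≋ s))) a≋0)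

    U⊆ : U ⊆ span (tuple k)
    U⊆ x x∈ = let a , a≋ = spanning x x∈ in
      a , ≋-trans (linearCombination-cong (λ _ → refl) tuple≋) a≋

    ⊆U : span (tuple k) ⊆ U
    ⊆U = span⊆ U (λ s → Subspace.resp U (≋-sym (tuple≋ s)) (vector∈ s))

    found : (d : Dec (LinearlyIndependent (tuple k))) →
            Maybe.Any (Setoid._≈_ (Grassmannian n j) (U , B)) (spanWhenIndependent (tuple k) d)
    found (yes _)   = Maybe.just (U⊆ , ⊆U)
    found (no ¬ind) = contradiction ind ¬ind

  grassmannianFinite : ∀ n j → ∃[ N ] Inverse (Grassmannian n j) (≡.setoid (Fin N))
  grassmannianFinite n j = finite (grassmannianDec n j) (grassmannianEnumeration n j)

  gaussianBinomial : ℕ → ℕ → ℕ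
  gaussianBinomial m j = proj₁ (grassmannianFinite m j)

open LinearAlgebra public
  using (V; Subspace; Basis; TrivialIntersection; trivialIntersection?; Grassmannian; gaussianBinomial)

Matrix : ℕ → ℕ → Set
Matrix m n = Fin m → Fin n → ℤ

infixl 7 _⊗_

_⊗_ : ∀ {l m n} → Matrix l m → Matrix m n → Matrix l n
(M ⊗ M′) i j = Sum.sum (λ k → M i k ℤ.* M′ k j)
  where import Algebra.Properties.Semiring.Sum ℤ.+-*-semiring as Sum

diagonal : ∀ {n} → Vector ℤ n → Matrix n n
diagonal d i j = if does (i Fin.≟ j) then d i else 0ℤ

identity : ∀ {n} → Matrix n n
identity = diagonal (λ _ → 1ℤ)

infix 4 _≐_

_≐_ : ∀ {m n} → Matrix m n → Matrix m n → Set
M ≐ M′ = ∀ i j → M i j ≡ M′ i j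

Unimodular : ∀ {n} → Matrix n n → Set
Unimodular P = ∃[ P′ ] (P ⊗ P′ ≐ identity × P′ ⊗ P ≐ identity)

-- d is the diagonal of the Smith normal form of M.  Since 0 ∣ m only
-- for m = 0, divisibility forces the zero entries to the end.
record IsSmithNormalForm {n} (M : Matrix n n) (d : Vector ℕ n) : Set where
  field
    left             : Matrix n n
    right            : Matrix n n
    left-unimodular  : Unimodular left
    right-unimodular : Unimodular right
    factorization    : left ⊗ M ⊗ right ≐ diagonal (λ i → ℤ.+ d i)
    divisibility     : ∀ i j → i Fin.≤ j → d i ∣ d j

ExactPower : ℕ → ℕ → ℕ → Set
ExactPower p i d = d ≢ 0 × p ℕ.^ i ∣ d × ¬ (p ℕ.^ suc i ∣ d)

exactPower? : ∀ p i d → Dec (ExactPower p i d)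
exactPower? p i d = ¬? (d ℕ.≟ 0) ×-dec (p ℕ.^ i ∣? d) ×-dec ¬? (p ℕ.^ suc i ∣? d)

-- The multiplicity of p ^ i as an elementary divisor of a matrix whose
-- Smith normal form has diagonal d.
multiplicity : ∀ {n} → ℕ → ℕ → Vector ℕ n → ℕ
multiplicity {n} p i d = length (filter (λ s → exactPower? p i (d s)) (allFin n))

module SkewLines {c ℓ} (F : FiniteField c ℓ) (n : ℕ) where

  -- Lines skew to a given line U: the gaussianBinomial F (n ∸ 2) 2 lines of
  -- the quotient by U, each lifting to q ^ 4 lines.  The truncation in
  -- n ∸ 2 only matters for n < 2.
  valency : ℕ
  valency = FiniteField.order F ℕ.^ 4 ℕ.* gaussianBinomial F (n ℕ.∸ 2) 2

  Vertex : Set (lsuc (c ⊔ ℓ))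
  Vertex = Setoid.Carrier (Grassmannian F n 2)

  Adjacent : Vertex → Vertex → Set (c ⊔ ℓ)
  Adjacent (U , _) (W , _) = TrivialIntersection F U W

  adjacent? : Decidable Adjacent
  adjacent? (U , B) (W , C) = trivialIntersection? F U W B C

  module _ {N} (vertices : Inverse (Grassmannian F n 2) (≡.setoid (Fin N))) where

    adjacency : Matrix N N
    adjacency i j =
      if does (adjacent? (Inverse.from vertices i) (Inverse.from vertices j)) then 1ℤ else 0ℤ

    laplacian : Matrix N N
    laplacian i j = ℤ.+ valency ℤ.* identity i j ℤ.- adjacency i j

{-# OPTIONS --safe #-}
-- Modulo p ^ 4t the Laplacian is - A, and the number of s with p ^ j ∣ dₛ is
-- determined by the matrix modulo p ^ j; this settles the multiplicities of
-- p ^ i for i < 4t.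
--
-- Let B be the incidence matrix of lines against nonzero vectors, C = B Bᵀ
-- and h = q - 1.  Counting common points gives C = h (J - A + q I), and
-- counting the lines through two vectors gives
-- C² = (q² - 1)² J + (r - 1) h C with r = (q ^ (n-1) - 1) / h.  As h L is
-- C + f I - h J with f = h (k - q), this yields
-- ((f + β) I - C) h L = (f + β) f I + (multiple of J) for β = (r - 1) h.
-- A Smith normal form turns that identity into dₛ ∣ (f + β) f for every
-- dₛ ≠ 0, and (f + β) f ≡ - q³ modulo q⁴, so q⁴ divides no nonzero dₛ.
module Submission where

open import Defs
open import Data.Bool.Base using (if_then_else_)
open import Data.Fin.Base as Fin using (Fin; finToFun; fromℕ<; funToFin; toℕ)
import Data.Fin.Properties as Fin
open import Data.Integer.Base as ℤ using (ℤ; +_; 0ℤ; 1ℤ)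
open import Data.Integer.DivMod using (_%ℕ_; _/ℕ_; a≡a%ℕn+[a/ℕn]*n; n%ℕd<d)
open import Data.Integer.Divisibility.Signed as ℤ using (divides; ∣ᵤ⇒∣; ∣⇒∣ᵤ)
import Data.Integer.Properties as ℤ
open import Data.Integer.Tactic.RingSolver using (solve-∀)
open import Data.List.Base using (List; []; _∷_; allFin; filter; length; lookup)
import Data.List.Membership.Propositional as List
open import Data.List.Membership.Propositional.Properties using (∈-allFin; ∈-filter⁺; ∈-filter⁻; ∈-lookup)
open import Data.List.Properties using (filter-accept; filter-none; filter-reject)
open import Data.List.Relation.Unary.All.Properties using (tabulate⁺)
open import Data.List.Relation.Unary.Any using (index)
open import Data.List.Relation.Unary.Any.Properties using (lookup-index)
open import Data.List.Relation.Unary.Unique.Propositional.Properties using (allFin⁺; filter⁺)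
open import Data.Nat.Base as ℕ using (ℕ; zero; suc; _*_; _^_; _≤_; _<_)
open import Data.Nat.Divisibility as ℕ using (_∣_; _∣?_)
open import Data.Nat.Primality using (Prime; euclidsLemma; prime⇒nonTrivial; prime⇒nonZero)
import Data.Nat.Properties as ℕ
open import Data.Product.Base using (Σ; ∃; ∃-syntax; _×_; _,_; proj₁; proj₂)
open import Data.Sum.Base using ([_,_]′)
open import Data.Unit.Base using (tt)
open import Data.Vec.Functional using (Vector)
open import Function.Base using (_∘_; case_of_; id)
open import Function.Bundles using (Inverse)
open import Relation.Binary.Definitions using (_Respects_)
open import Relation.Binary.PropositionalEquality
  using (_≡_; _≢_; _≗_; refl; sym; trans; cong; cong₂; subst; setoid; module ≡-Reasoning)
open import Relation.Nullary.Decidable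
  using (Dec; yes; no; does; ¬?; _×-dec_; dec-false; dec-true; decidable-stable)
open import Relation.Nullary.Negation using (¬_; contradiction)
open import Relation.Unary using (Decidable; Pred)

open import Algebra.Properties.Semiring.Sum ℤ.+-*-semiring
  using (sum; sum-cong-≗; sum-replicate-zero; ∑-distrib-+; ∑-comm; *-distribˡ-sum; *-distribʳ-sum)

-- Finite sums and indicators

-- Eigenvalues alone do not determine a Smith form over the integers, but an annihilating polynomial
-- survives in divisibility form. On vectors of sum zero `C` satisfies `C (C - β I) = 0`, so there
-- `h L` has eigenvalues `f` and `f + β`, and their product bounds every nonzero diagonal entry.
-- Modulo `q ^ 4` one has `f ≡ - h q` and `f + β ≡ q ^ (n-1) - q ^ 2`: since `n ≥ 4`, exactly one
-- and two factors `q`, hence exactly three in the product. Counting nonzero vectors instead of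
-- projective points avoids enumerating the points and costs only factors `h`, which are prime to
-- `p` because `h ≡ - 1` modulo `q`. The valency is given by a formula whose Gaussian binomial is
-- the size of an enumeration. That `L` annihilates the all-ones vector is therefore a counting
-- theorem, which links the lines of the spaces of dimensions `n` and `n - 2`.

indicator : ∀ {a} {A : Set a} → Dec A → ℤ
indicator d = if does d then 1ℤ else 0ℤ

indicator-true : ∀ {a} {A : Set a} (d : Dec A) → A → indicator d ≡ 1ℤ
indicator-true (yes _) _ = refl
indicator-true (no ¬a) a = contradiction a ¬a

indicator-false : ∀ {a} {A : Set a} (d : Dec A) → ¬ A → indicator d ≡ 0ℤ
indicator-false (yes a) ¬a = contradiction a ¬a
indicator-false (no _)  _  = refl

sum-zero : ∀ {n} {f : Vector ℤ n} → (∀ i → f i ≡ 0ℤ) → sum f ≡ 0ℤ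
sum-zero {n} f≡0 = trans (sum-cong-≗ f≡0) (sum-replicate-zero n)

sum-single : ∀ {n} (f : Vector ℤ n) i → (∀ j → j ≢ i → f j ≡ 0ℤ) → sum f ≡ f i
sum-single f Fin.zero z =
  trans (cong₂ ℤ._+_ (refl {x = f Fin.zero}) (sum-zero (λ j → z (Fin.suc j) λ ()))) (ℤ.+-identityʳ _)
sum-single f (Fin.suc i) z =
  trans (cong₂ ℤ._+_ (z Fin.zero λ ())
                     (sum-single (f ∘ Fin.suc) i (λ j j≢i → z (Fin.suc j) (j≢i ∘ Fin.suc-injective))))
        (ℤ.+-identityˡ _)

indicator-cong : ∀ {a b} {A : Set a} {B : Set b} (d : Dec A) (e : Dec B) →
                 (A → B) → (B → A) → indicator d ≡ indicator e
indicator-cong (yes a) e f g = sym (indicator-true e (f a))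
indicator-cong (no ¬a) e f g = sym (indicator-false e (¬a ∘ g))

indicator-×-¬ : ∀ {a b} {A : Set a} {B : Set b} (d : Dec A) (e : Dec B) → (B → A) →
                indicator (d ×-dec ¬? e) ≡ indicator d ℤ.- indicator e
indicator-×-¬ (yes _) (yes _) _   = refl
indicator-×-¬ (yes _) (no _)  _   = refl
indicator-×-¬ (no ¬a) (yes b) B⇒A = contradiction (B⇒A b) ¬a
indicator-×-¬ (no _)  (no _)  _   = refl

indicator-× : ∀ {a b} {A : Set a} {B : Set b} (d : Dec A) (e : Dec B) →
              indicator (d ×-dec e) ≡ indicator d ℤ.* indicator e
indicator-× (yes _) (yes _) = refl
indicator-× (yes _) (no _)  = refl
indicator-× (no _)  _       = refl

indicator-¬ : ∀ {a} {A : Set a} (d : Dec A) → indicator (¬? d) ≡ 1ℤ ℤ.- indicator d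
indicator-¬ (yes _) = refl
indicator-¬ (no _)  = refl

indicator-*-cong : ∀ {a} {A : Set a} (d : Dec A) {z w} → (A → z ≡ w) →
                   indicator d ℤ.* z ≡ indicator d ℤ.* w
indicator-*-cong (yes a) z≡w = cong (1ℤ ℤ.*_) (z≡w a)
indicator-*-cong (no _)  _   = refl

-- The common form of the double counts below: a fibre has at most one element, and `A` says whether
-- it has one.
indicator-unique : ∀ {a p n} {A : Set a} {P : Pred (Fin n) p} (d : Dec A) (P? : Decidable P) →
                   (A → ∃ P) → (∀ {i} → P i → A) → (∀ {i j} → P i → P j → i ≡ j) →
                   sum (λ i → indicator (P? i)) ≡ indicator d
indicator-unique (yes a) P? ∃P _ P! =
  let i , Pi = ∃P a in
  trans (sum-single _ i (λ j j≢i → indicator-false (P? j) (λ Pj → j≢i (P! Pj Pi))))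
        (indicator-true (P? i) Pi)
indicator-unique (no ¬a) P? _ P⇒A _ = sum-zero (λ i → indicator-false (P? i) (¬a ∘ P⇒A))

sum-const : ∀ n z → sum {n} (λ _ → z) ≡ + n ℤ.* z
sum-const zero    z = refl
sum-const (suc n) z = trans (cong₂ ℤ._+_ (refl {x = z}) (sum-const n z)) (sym (ℤ.suc-* (+ n) z))

sum-difference : ∀ {n} (f g : Vector ℤ n) → sum (λ i → f i ℤ.- g i) ≡ sum f ℤ.- sum g
sum-difference f g = trans (∑-distrib-+ f (λ i → ℤ.- g i))
  (cong₂ ℤ._+_ (refl {x = sum f}) (trans (sum-cong-≗ (λ i → sym (ℤ.-1*i≡-i (g i))))
    (trans (sym (*-distribˡ-sum ℤ.-1ℤ g)) (ℤ.-1*i≡-i _))))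

0≤indicator : ∀ {a} {A : Set a} (d : Dec A) → 0ℤ ℤ.≤ indicator d
0≤indicator (yes _) = ℤ.+≤+ ℕ.z≤n
0≤indicator (no _)  = ℤ.+≤+ ℕ.z≤n

0≤sum : ∀ {n} {f : Vector ℤ n} → (∀ i → 0ℤ ℤ.≤ f i) → 0ℤ ℤ.≤ sum f
0≤sum {zero}  _   = ℤ.≤-refl
0≤sum {suc n} 0≤f = ℤ.+-mono-≤ (0≤f Fin.zero) (0≤sum (0≤f ∘ Fin.suc))

term≤sum : ∀ {n} {f : Vector ℤ n} → (∀ i → 0ℤ ℤ.≤ f i) → ∀ i → f i ℤ.≤ sum f
term≤sum {f = f} 0≤f Fin.zero =
  subst (ℤ._≤ sum f) (ℤ.+-identityʳ (f Fin.zero)) (ℤ.+-mono-≤ (ℤ.≤-refl {f Fin.zero}) (0≤sum (0≤f ∘ Fin.suc)))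
term≤sum {f = f} 0≤f (Fin.suc i) =
  subst (ℤ._≤ sum f) (ℤ.+-identityˡ _) (ℤ.+-mono-≤ (0≤f Fin.zero) (term≤sum (0≤f ∘ Fin.suc) i))

-- Turns a vanishing count back into emptiness; this works because indicators are nonnegative.
sum-indicator-zero : ∀ {n p} {P : Pred (Fin n) p} (P? : Decidable P) →
                     sum (λ i → indicator (P? i)) ≡ 0ℤ → ∀ i → ¬ P i
sum-indicator-zero P? Σ≡0 i Pi =
  case subst (indicator (P? i) ℤ.≤_) Σ≡0 (term≤sum (λ j → 0≤indicator (P? j)) i) of λ le →
  case subst (ℤ._≤ 0ℤ) (indicator-true (P? i) Pi) le of λ { (ℤ.+≤+ ()) }

∣-sum : ∀ {n m} {f : Vector ℤ n} → (∀ i → m ℤ.∣ f i) → m ℤ.∣ sum f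
∣-sum {zero}  _   = divides 0ℤ refl
∣-sum {suc n} m∣f = ℤ.∣m∣n⇒∣m+n (m∣f Fin.zero) (∣-sum (m∣f ∘ Fin.suc))

pos-^ : ∀ m n → + (m ^ n) ≡ (+ m) ℤ.^ n
pos-^ m zero    = refl
pos-^ m (suc n) = trans (ℤ.pos-* m (m ^ n)) (cong (+ m ℤ.*_) (pos-^ m n))

-- Matrices acting on column vectors

infixr 8 _·_
_·_ : ∀ {m n} → Matrix m n → Vector ℤ n → Vector ℤ m
(M · x) i = sum (λ k → M i k ℤ.* x k)

·-cong : ∀ {m n} (M : Matrix m n) {x y} → x ≗ y → M · x ≗ M · y
·-cong M x≗y i = sum-cong-≗ (λ k → cong (M i k ℤ.*_) (x≗y k))

·-congˡ : ∀ {m n} {M M′ : Matrix m n} → M ≐ M′ → ∀ x → M · x ≗ M′ · x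
·-congˡ M≐M′ x i = sum-cong-≗ (λ k → cong (ℤ._* x k) (M≐M′ i k))

·-assoc : ∀ {l m n} (M : Matrix l m) (M′ : Matrix m n) x → (M ⊗ M′) · x ≗ M · M′ · x
·-assoc M M′ x i = begin
  sum (λ k → sum (λ j → M i j ℤ.* M′ j k) ℤ.* x k)
    ≡⟨ sum-cong-≗ (λ k → *-distribʳ-sum (x k) (λ j → M i j ℤ.* M′ j k)) ⟩
  sum (λ k → sum (λ j → M i j ℤ.* M′ j k ℤ.* x k))
    ≡⟨ ∑-comm (λ k j → M i j ℤ.* M′ j k ℤ.* x k) ⟩
  sum (λ j → sum (λ k → M i j ℤ.* M′ j k ℤ.* x k))
    ≡⟨ sum-cong-≗ (λ j → sum-cong-≗ (λ k → ℤ.*-assoc (M i j) (M′ j k) (x k))) ⟩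
  sum (λ j → sum (λ k → M i j ℤ.* (M′ j k ℤ.* x k)))
    ≡⟨ sum-cong-≗ (λ j → sym (*-distribˡ-sum (M i j) (λ k → M′ j k ℤ.* x k))) ⟩
  sum (λ j → M i j ℤ.* sum (λ k → M′ j k ℤ.* x k)) ∎
  where open ≡-Reasoning

diagonal-· : ∀ {n} (d x : Vector ℤ n) i → (diagonal d · x) i ≡ d i ℤ.* x i
diagonal-· d x i = trans
  (sum-single _ i (λ j j≢i → cong (ℤ._* x j) (off j (j≢i ∘ sym))))
  (cong (ℤ._* x i) on)
  where
  off : ∀ j → i ≢ j → diagonal d i j ≡ 0ℤ
  off j i≢j rewrite dec-false (i Fin.≟ j) i≢j = refl
  on : diagonal d i i ≡ d i
  on rewrite dec-true (i Fin.≟ i) refl = refl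

identity-· : ∀ {n} (x : Vector ℤ n) → identity · x ≗ x
identity-· x i = trans (diagonal-· (λ _ → 1ℤ) x i) (ℤ.*-identityˡ (x i))

inverse-· : ∀ {n} (P P′ : Matrix n n) → P ⊗ P′ ≐ identity → ∀ x → P · P′ · x ≗ x
inverse-· P P′ PP′≐1 x i =
  trans (sym (·-assoc P P′ x i)) (trans (·-congˡ PP′≐1 x i) (identity-· x i))

·-difference : ∀ {m n} (M : Matrix m n) (x y : Vector ℤ n) i →
               (M · (λ k → x k ℤ.- y k)) i ≡ (M · x) i ℤ.- (M · y) i
·-difference M x y i = begin
  sum (λ k → M i k ℤ.* (x k ℤ.- y k))
    ≡⟨ sum-cong-≗ (λ k → lem (M i k) (x k) (y k)) ⟩
  sum (λ k → M i k ℤ.* x k ℤ.+ ℤ.-1ℤ ℤ.* (M i k ℤ.* y k))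
    ≡⟨ ∑-distrib-+ (λ k → M i k ℤ.* x k) (λ k → ℤ.-1ℤ ℤ.* (M i k ℤ.* y k)) ⟩
  (M · x) i ℤ.+ sum (λ k → ℤ.-1ℤ ℤ.* (M i k ℤ.* y k))
    ≡⟨ cong₂ ℤ._+_ (refl {x = (M · x) i}) (sym (*-distribˡ-sum ℤ.-1ℤ (λ k → M i k ℤ.* y k))) ⟩
  (M · x) i ℤ.+ ℤ.-1ℤ ℤ.* (M · y) i
    ≡⟨ cong₂ ℤ._+_ (refl {x = (M · x) i}) (ℤ.-1*i≡-i _) ⟩
  (M · x) i ℤ.- (M · y) i ∎
  where
  open ≡-Reasoning
  lem : ∀ m x y → m ℤ.* (x ℤ.- y) ≡ m ℤ.* x ℤ.+ ℤ.-1ℤ ℤ.* (m ℤ.* y)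
  lem = solve-∀

∣-· : ∀ {m n} (M : Matrix m n) {x : Vector ℤ n} {a} →
      (∀ k → a ℤ.∣ x k) → ∀ i → a ℤ.∣ (M · x) i
∣-· M a∣x i = ∣-sum (λ k → ℤ.∣n⇒∣m*n (M i k) (a∣x k))

∣-resp : ∀ {a x y} → x ≡ y → a ℤ.∣ x → a ℤ.∣ y
∣-resp refl a∣x = a∣x

-- Smith normal forms

module SmithNormalForm {n} {M : Matrix n n} {d : Vector ℕ n} (snf : IsSmithNormalForm M d) where
  open IsSmithNormalForm snf public
  P Q P⁻¹ Q⁻¹ : Matrix n n
  P   = left
  Q   = right
  P⁻¹ = proj₁ left-unimodular
  Q⁻¹ = proj₁ right-unimodular

  P⁻¹P : ∀ x → P⁻¹ · P · x ≗ x
  P⁻¹P = inverse-· P⁻¹ P (proj₂ (proj₂ left-unimodular))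

  QQ⁻¹ : ∀ x → Q · Q⁻¹ · x ≗ x
  QQ⁻¹ = inverse-· Q Q⁻¹ (proj₁ (proj₂ right-unimodular))

  Q⁻¹Q : ∀ x → Q⁻¹ · Q · x ≗ x
  Q⁻¹Q = inverse-· Q⁻¹ Q (proj₂ (proj₂ right-unimodular))

  PMQ : ∀ x i → (P · M · Q · x) i ≡ + d i ℤ.* x i
  PMQ x i = begin
    (P · M · Q · x) i         ≡⟨ sym (·-assoc P M (Q · x) i) ⟩
    ((P ⊗ M) · Q · x) i       ≡⟨ sym (·-assoc (P ⊗ M) Q x i) ⟩
    ((P ⊗ M ⊗ Q) · x) i       ≡⟨ ·-congˡ factorization x i ⟩
    (diagonal (λ k → + d k) · x) i ≡⟨ diagonal-· (λ k → + d k) x i ⟩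
    + d i ℤ.* x i ∎
    where open ≡-Reasoning

  -- `M Q = P⁻¹ D`, and an integer matrix preserves divisibility of all entries.
  MQ : ∀ {a} x → (∀ i → a ℤ.∣ + d i ℤ.* x i) → ∀ i → a ℤ.∣ (M · Q · x) i
  MQ x a∣dx i = ∣-resp (P⁻¹P (M · Q · x) i)
    (∣-· P⁻¹ (λ k → ∣-resp (sym (PMQ x k)) (a∣dx k)) i)

-- A right-hand column x = Q eₛ satisfies L x = dₛ P⁻¹ eₛ, while row s of
-- Q⁻¹ kills the vector 1 (as L does) and maps x to 1.
module _ {n} {L : Matrix n n} {d : Vector ℕ n} (snf : IsSmithNormalForm L d) {m : ℤ}
         (L1≡0 : ∀ i → (L · (λ _ → 1ℤ)) i ≡ 0ℤ)
         (reduce : ∀ a x → (∀ i → a ℤ.∣ (L · x) i) → ∃[ c ] ∀ i → a ℤ.∣ m ℤ.* x i ℤ.+ c) where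
  open SmithNormalForm snf

  nonzero∣ : ∀ s → d s ≢ 0 → + d s ℤ.∣ m
  -- All entries of `m x + c` are multiples of `d s`. Row `s` of `Q⁻¹` sends this vector to `m`,
  -- whatever the constant `c` may be.
  nonzero∣ s ds≢0 = ∣-resp eq (∣-· Q⁻¹ {x = λ k → m ℤ.* (Q · e) k ℤ.+ c} a∣ s)
    where
    open ≡-Reasoning
    e : Vector ℤ n
    e k = indicator (k Fin.≟ s)

    a∣de : ∀ i → + d s ℤ.∣ + d i ℤ.* e i
    a∣de i with i Fin.≟ s
    ... | yes refl = ℤ.∣m⇒∣m*n 1ℤ ℤ.∣-refl
    ... | no  _    = divides 0ℤ (ℤ.*-zeroʳ (+ d i))

    reduced = reduce (+ d s) (Q · e) (MQ e a∣de)
    c  = proj₁ reduced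
    a∣ = proj₂ reduced

    u : Vector ℤ n
    u = Q⁻¹ · (λ _ → 1ℤ)

    -- Row `s` of `P L Q = D`, applied to `u`: here `Q u` is the all-ones vector, which `L` kills.
    du≡0 : + d s ℤ.* u s ≡ 0ℤ
    du≡0 = begin
      + d s ℤ.* u s       ≡⟨ sym (PMQ u s) ⟩
      (P · L · Q · u) s   ≡⟨ ·-cong P (·-cong L (QQ⁻¹ (λ _ → 1ℤ))) s ⟩
      (P · L · (λ _ → 1ℤ)) s ≡⟨ ·-cong P L1≡0 s ⟩
      (P · (λ _ → 0ℤ)) s ≡⟨ sum-zero (λ k → ℤ.*-zeroʳ (P s k)) ⟩
      0ℤ ∎

    u≡0 : u s ≡ 0ℤ
    u≡0 = [ (λ ds≡0 → contradiction (ℤ.+-injective ds≡0) ds≢0) , id ]′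
            (ℤ.i*j≡0⇒i≡0∨j≡0 (+ d s) du≡0)

    lem₁ : ∀ w m x c → w ℤ.* (m ℤ.* x ℤ.+ c) ≡ m ℤ.* (w ℤ.* x) ℤ.+ c ℤ.* (w ℤ.* 1ℤ)
    lem₁ = solve-∀

    eq : (Q⁻¹ · (λ k → m ℤ.* (Q · e) k ℤ.+ c)) s ≡ m
    eq = begin
      sum (λ k → Q⁻¹ s k ℤ.* (m ℤ.* (Q · e) k ℤ.+ c))
        ≡⟨ sum-cong-≗ (λ k → lem₁ (Q⁻¹ s k) m ((Q · e) k) c) ⟩
      sum (λ k → m ℤ.* (Q⁻¹ s k ℤ.* (Q · e) k) ℤ.+ c ℤ.* (Q⁻¹ s k ℤ.* 1ℤ))
        ≡⟨ ∑-distrib-+ (λ k → m ℤ.* (Q⁻¹ s k ℤ.* (Q · e) k)) (λ k → c ℤ.* (Q⁻¹ s k ℤ.* 1ℤ)) ⟩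
      sum (λ k → m ℤ.* (Q⁻¹ s k ℤ.* (Q · e) k)) ℤ.+ sum (λ k → c ℤ.* (Q⁻¹ s k ℤ.* 1ℤ))
        ≡⟨ cong₂ ℤ._+_ (sym (*-distribˡ-sum m (λ k → Q⁻¹ s k ℤ.* (Q · e) k)))
                       (sym (*-distribˡ-sum c (λ k → Q⁻¹ s k ℤ.* 1ℤ))) ⟩
      m ℤ.* (Q⁻¹ · Q · e) s ℤ.+ c ℤ.* u s
        ≡⟨ cong₂ (λ a b → m ℤ.* a ℤ.+ c ℤ.* b)
             (trans (Q⁻¹Q e s) (indicator-true (s Fin.≟ s) refl)) u≡0 ⟩
      m ℤ.* 1ℤ ℤ.+ c ℤ.* 0ℤ
        ≡⟨ cong₂ ℤ._+_ (ℤ.*-identityʳ m) (ℤ.*-zeroʳ c) ⟩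
      m ℤ.+ 0ℤ ≡⟨ ℤ.+-identityʳ m ⟩
      m ∎

-- Multiplicities and divisibility counts

countMultiples : ∀ {n} → ℕ → Vector ℕ n → ℕ
countMultiples {n} a d = length (filter (λ s → a ∣? d s) (allFin n))

-- The induction descends to the exact power of `p` in `d`. Cancelling that power leaves `p ∣ e * w`
-- with `p` not dividing `e`, and Euclid's lemma applies.
p^j∣d*w⇒p∣w : ∀ {p} → Prime p → ∀ j d w → p ^ j ∣ d * w → ¬ (p ^ j ∣ d) → p ∣ w
p^j∣d*w⇒p∣w pr zero d w _ ¬1∣d = contradiction (ℕ.1∣ d) ¬1∣d
p^j∣d*w⇒p∣w {p} pr (suc j) d w pj∣ ¬pj∣d with p ^ j ∣? d
... | no ¬pj = p^j∣d*w⇒p∣w pr j d w (ℕ.∣-trans (ℕ.n∣m*n p) pj∣) ¬pj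
... | yes (ℕ.divides e refl) = [ (λ p∣e → contradiction (ℕ.*-monoˡ-∣ (p ^ j) p∣e) ¬pj∣d) , id ]′
        (euclidsLemma e w pr (ℕ.*-cancelʳ-∣ (p ^ j) (subst (p * p ^ j ∣_) eq pj∣)))
  where
  instance _ = prime⇒nonZero pr
           _ = ℕ.m^n≢0 p j
  eq : e * p ^ j * w ≡ e * w * p ^ j
  eq = trans (ℕ.*-assoc e _ w) (trans (cong (e *_) (ℕ.*-comm (p ^ j) w)) (sym (ℕ.*-assoc e w _)))

funToFin-cong : ∀ {m n} {f g : Fin m → Fin n} → f ≗ g → funToFin f ≡ funToFin g
funToFin-cong {zero}  _   = refl
funToFin-cong {suc m} f≗g = cong₂ Fin.combine (f≗g Fin.zero) (funToFin-cong (f≗g ∘ Fin.suc))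

≡%⇒∣- : ∀ x y a .{{_ : ℕ.NonZero a}} → x %ℕ a ≡ y %ℕ a → + a ℤ.∣ x ℤ.- y
≡%⇒∣- x y a eq = divides (x /ℕ a ℤ.- y /ℕ a) (begin
  x ℤ.- y ≡⟨ cong₂ ℤ._-_ (a≡a%ℕn+[a/ℕn]*n x a) (a≡a%ℕn+[a/ℕn]*n y a) ⟩
  (+ (x %ℕ a) ℤ.+ x /ℕ a ℤ.* + a) ℤ.- (+ (y %ℕ a) ℤ.+ y /ℕ a ℤ.* + a)
    ≡⟨ cong (λ r → (+ r ℤ.+ x /ℕ a ℤ.* + a) ℤ.- (+ (y %ℕ a) ℤ.+ y /ℕ a ℤ.* + a)) eq ⟩
  (+ (y %ℕ a) ℤ.+ x /ℕ a ℤ.* + a) ℤ.- (+ (y %ℕ a) ℤ.+ y /ℕ a ℤ.* + a)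
    ≡⟨ lem (+ (y %ℕ a)) (x /ℕ a) (y /ℕ a) (+ a) ⟩
  (x /ℕ a ℤ.- y /ℕ a) ℤ.* + a ∎)
  where
  open ≡-Reasoning
  lem : ∀ r u v a → (r ℤ.+ u ℤ.* a) ℤ.- (r ℤ.+ v ℤ.* a) ≡ (u ℤ.- v) ℤ.* a
  lem = solve-∀

toℕ-≡-mod : ∀ {a} (x y : Fin a) → + a ℤ.∣ + toℕ x ℤ.- + toℕ y → x ≡ y
toℕ-≡-mod {a} x y a∣x-y = Fin.toℕ-injective (ℤ.+-injective (ℤ.i-j≡0⇒i≡j (+ toℕ x) (+ toℕ y)
  (ℤ.∣i∣≡0⇒i≡0 (small (ℤ.∣ + toℕ x ℤ.- + toℕ y ∣) (∣⇒∣ᵤ a∣x-y) bound))))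
  where
  small : ∀ m → a ∣ m → m < a → m ≡ 0
  small zero    _   _   = refl
  small (suc m) a∣m m<a = contradiction m<a (ℕ.≤⇒≯ (ℕ.∣⇒≤ a∣m))
  bound : ℤ.∣ + toℕ x ℤ.- + toℕ y ∣ < a
  bound = ℕ.≤-<-trans
    (subst (λ m → ℤ.∣ m ∣ ≤ toℕ x ℕ.⊔ toℕ y) (sym (ℤ.m-n≡m⊖n (toℕ x) (toℕ y)))
      (ℤ.∣m⊝n∣≤m⊔n (toℕ x) (toℕ y)))
    (ℕ.⊔-pres-<m (Fin.toℕ<n x) (Fin.toℕ<n y))

^-cancelʳ-≤ : ∀ a {m n} → 1 < a → a ^ m ≤ a ^ n → m ≤ n
^-cancelʳ-≤ a 1<a am≤an = ℕ.≮⇒≥ (λ n<m → ℕ.<⇒≱ (ℕ.^-monoʳ-< a 1<a n<m) am≤an)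

-- The number of s with p ^ j ∣ d s is the dimension of the reduction mod p
-- of { x ∣ M x ≡ 0 mod p ^ j }; compare p ^ (number) by pigeonhole.
module _ {n p} (pr : Prime p) {M M′ : Matrix n n} {d d′ : Vector ℕ n}
         (snf : IsSmithNormalForm M d) (snf′ : IsSmithNormalForm M′ d′) (j : ℕ)
         (kernel⊆ : ∀ x → (∀ i → + (p ^ j) ℤ.∣ (M · x) i) → ∀ i → + (p ^ j) ℤ.∣ (M′ · x) i) where

  private
    module S  = SmithNormalForm snf
    module S′ = SmithNormalForm snf′

    instance
      p≢0 : ℕ.NonZero p
      p≢0 = prime⇒nonZero pr

    multiples multiples′ : List (Fin n)
    multiples  = filter (λ s → p ^ j ∣? d s) (allFin n)
    multiples′ = filter (λ s → p ^ j ∣? d′ s) (allFin n)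

    -- The inclusion of the coordinates `s` with `p ^ j ∣ d s`. It is chosen so that every
    -- `Q · extend · z` lies in the kernel of `M` modulo `p ^ j`.
    extend : Matrix n (length multiples)
    extend s r = indicator (s Fin.≟ lookup multiples r)

    extend-at : ∀ z r → (extend · z) (lookup multiples r) ≡ z r
    extend-at z r = trans
      (sum-single _ r (λ r′ r′≢r → cong (ℤ._* z r′)
        (indicator-false (lookup multiples r Fin.≟ lookup multiples r′) (λ eq → r′≢r (inj r′ r (sym eq))))))
      (trans (cong (ℤ._* z r) (indicator-true (lookup multiples r Fin.≟ lookup multiples r) refl))
             (ℤ.*-identityˡ (z r)))
      where inj = lookup-injective (Fin.≡-decSetoid n) (filter⁺ (λ s → p ^ j ∣? d s) (allFin⁺ n))

    ∣d·extend : ∀ z s → + (p ^ j) ℤ.∣ + d s ℤ.* (extend · z) s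
    ∣d·extend z s with p ^ j ∣? d s
    ... | yes pj∣ds = ℤ.∣m⇒∣m*n {m = + d s} ((extend · z) s) (∣ᵤ⇒∣ pj∣ds)
    ... | no ¬pj∣ds = divides 0ℤ (trans (cong (+ d s ℤ.*_) (sum-zero (λ r → cong (ℤ._* z r)
            (indicator-false (s Fin.≟ lookup multiples r) (λ { refl →
              ¬pj∣ds (proj₂ (∈-filter⁻ (λ s → p ^ j ∣? d s) {xs = allFin n} (∈-lookup r))) }))))) (ℤ.*-zeroʳ (+ d s)))

    -- The kernel vector `Q · extend · z` of `M`, in the coordinates that diagonalise `M′`.
    image : Vector ℤ (length multiples) → Vector ℤ n
    image z = S′.Q⁻¹ · S.Q · extend · z

    -- By `kernel⊆` the vector also lies in the kernel of `M′`, so `p ^ j` divides `d′ s` times its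
    -- coordinate. Hence modulo `p` the image is supported on `multiples′`.
    image-∣ : ∀ z s → ¬ (p ^ j ∣ d′ s) → + p ℤ.∣ image z s
    image-∣ z s ¬pj∣ = ∣ᵤ⇒∣ (p^j∣d*w⇒p∣w pr j (d′ s) (ℤ.∣ image z s ∣)
      (subst (p ^ j ∣_) (ℤ.abs-* (+ d′ s) (image z s)) (∣⇒∣ᵤ pj∣)) ¬pj∣)
      where
      pj∣ : + (p ^ j) ℤ.∣ + d′ s ℤ.* image z s
      pj∣ = ∣-resp (trans (·-cong S′.P (·-cong M′ (λ i → sym (S′.QQ⁻¹ (S.Q · extend · z) i))) s)
                          (S′.PMQ (image z) s))
              (∣-· S′.P (kernel⊆ (S.Q · extend · z) (S.MQ (extend · z) (∣d·extend z))) s)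

    digits : (Fin (length multiples) → Fin p) → Vector ℤ (length multiples)
    digits ζ r = + toℕ (ζ r)

    -- The induced linear map over the field of `p` elements, kept as a plain function between
    -- finite sets so that pigeonhole takes the place of dimension theory.
    residues : (Fin (length multiples) → Fin p) → Fin (length multiples′) → Fin p
    residues ζ r = fromℕ< (n%ℕd<d (image (digits ζ) (lookup multiples′ r)) p)

    -- Equal residues make the image of the difference divisible by `p` on `multiples′`, and
    -- `image-∣` covers the other coordinates. Undoing the unimodular matrices returns to
    -- `extend · δ`, whose entries include every `δ r`.
    residues-injective : ∀ ζ ξ → residues ζ ≗ residues ξ → ζ ≗ ξ
    residues-injective ζ ξ eq r = toℕ-≡-mod (ζ r) (ξ r)
      (∣-resp (extend-at δ r) (∣-resp (S.Q⁻¹Q (extend · δ) (lookup multiples r))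
        (∣-· S.Q⁻¹ (λ k → ∣-resp (S′.QQ⁻¹ (S.Q · extend · δ) k) (∣-· S′.Q p∣ k)) (lookup multiples r))))
      where
      δ : Vector ℤ (length multiples)
      δ r = digits ζ r ℤ.- digits ξ r

      image-δ : ∀ s → image δ s ≡ image (digits ζ) s ℤ.- image (digits ξ) s
      image-δ s = trans
        (·-cong S′.Q⁻¹ (λ k → trans
          (·-cong S.Q (·-difference extend (digits ζ) (digits ξ)) k)
          (·-difference S.Q (extend · digits ζ) (extend · digits ξ) k)) s)
        (·-difference S′.Q⁻¹ (S.Q · extend · digits ζ) (S.Q · extend · digits ξ) s)

      p∣ : ∀ s → + p ℤ.∣ image δ s
      p∣ s with p ^ j ∣? d′ s
      ... | no ¬pj∣ = image-∣ δ s ¬pj∣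
      ... | yes pj∣ = ∣-resp (sym (image-δ s)) (≡%⇒∣- (image (digits ζ) s) (image (digits ξ) s) p
              (subst (λ s → image (digits ζ) s %ℕ p ≡ image (digits ξ) s %ℕ p)
                     (sym (lookup-index s∈)) (Fin.fromℕ<-injective _ _ (bound ζ) (bound ξ) (eq (index s∈)))))
        where
        s∈ : s List.∈ multiples′
        s∈ = ∈-filter⁺ (λ s → p ^ j ∣? d′ s) (∈-allFin s) pj∣
        bound : ∀ ζ → image (digits ζ) (lookup multiples′ (index s∈)) %ℕ p < p
        bound ζ = n%ℕd<d (image (digits ζ) (lookup multiples′ (index s∈))) p

  countMultiples-mono : countMultiples (p ^ j) d ≤ countMultiples (p ^ j) d′
  countMultiples-mono = ^-cancelʳ-≤ p (ℕ.nonTrivial⇒n>1 p {{prime⇒nonTrivial pr}})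
    (Fin.injective⇒≤ {f = λ k → funToFin (residues (finToFun k))} (λ {k} {k′} eq →
      trans (sym (Fin.funToFin-finToFin {length multiples} k)) (trans
        (funToFin-cong (residues-injective (finToFun k) (finToFun k′) (λ r →
          trans (sym (Fin.finToFun-funToFin (residues (finToFun k)) r))
          (trans (cong (λ c → finToFun c r) eq)
                 (Fin.finToFun-funToFin (residues (finToFun k′)) r)))))
        (Fin.funToFin-finToFin {length multiples} k′))))

-- Zero entries are multiples of every power, so they occur in both counts and cancel.
-- Multiplicities of nonzero entries are thus differences of counts that include the zeros.
multiplicity+ : ∀ {n} p i (d : Vector ℕ n) →
                multiplicity p i d ℕ.+ countMultiples (p ^ suc i) d ≡ countMultiples (p ^ i) d
multiplicity+ {n} p i d = go (allFin n)
  where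
  go : ∀ xs → length (filter (λ s → exactPower? p i (d s)) xs) ℕ.+
              length (filter (λ s → p ^ suc i ∣? d s) xs) ≡
              length (filter (λ s → p ^ i ∣? d s) xs)
  go [] = refl
  go (x ∷ xs) = case p ^ suc i ∣? d x of λ where
    (yes big) → trans
      (cong₂ ℕ._+_
        (cong length (filter-reject (λ s → exactPower? p i (d s)) {x} {xs} (λ (_ , _ , ¬big) → ¬big big)))
        (cong length (filter-accept (λ s → p ^ suc i ∣? d s) {x} {xs} big)))
      (trans (ℕ.+-suc _ _) (trans (cong suc (go xs))
        (sym (cong length (filter-accept (λ s → p ^ i ∣? d s) {x} {xs} (ℕ.∣-trans (ℕ.n∣m*n p) big))))))
    (no ¬big) → case p ^ i ∣? d x of λ where
      (yes small) → trans
        (cong₂ ℕ._+_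
          (cong length (filter-accept (λ s → exactPower? p i (d s)) {x} {xs}
            ((λ dx≡0 → ¬big (subst (p ^ suc i ∣_) (sym dx≡0) ((p ^ suc i) ℕ.∣0))) , small , ¬big)))
          (cong length (filter-reject (λ s → p ^ suc i ∣? d s) {x} {xs} ¬big)))
        (trans (cong suc (go xs))
          (sym (cong length (filter-accept (λ s → p ^ i ∣? d s) {x} {xs} small))))
      (no ¬small) → trans
        (cong₂ ℕ._+_
          (cong length (filter-reject (λ s → exactPower? p i (d s)) {x} {xs} (λ (_ , small , _) → ¬small small)))
          (cong length (filter-reject (λ s → p ^ suc i ∣? d s) {x} {xs} ¬big)))
        (trans (go xs)
          (sym (cong length (filter-reject (λ s → p ^ i ∣? d s) {x} {xs} ¬small))))

multiplicity≡0 : ∀ {n} p i (d : Vector ℕ n) → (∀ s → ¬ ExactPower p i (d s)) → multiplicity p i d ≡ 0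
multiplicity≡0 p i d none =
  cong length (filter-none (λ s → exactPower? p i (d s)) (tabulate⁺ none))

-- Counting vectors of a finite vector space

module Counting {c ℓ} (F : FiniteField c ℓ) where
  open FiniteField F using (_≈_; 0#; 1#; order; enumeration; invertible; 0≉1;
    *-congˡ; *-congʳ; *-identityˡ; *-assoc; *-comm; zeroˡ; zeroʳ;
    +-cong; +-congˡ; +-congʳ; +-identityʳ; +-identityˡ; -‿inverseˡ; -‿inverseʳ; +-assoc)
    renaming (_+_ to _+ᶠ_; _*_ to _*ᶠ_; -_ to -ᶠ_; sym to ≈-sym; trans to ≈-trans; ring to ringᶠ;
              setoid to ≈-setoid)
  open LinearAlgebra F hiding (V; Subspace; Basis; TrivialIntersection; trivialIntersection?;
                                   Grassmannian; gaussianBinomial; _≟_)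
  open import Algebra.Properties.Ring ringᶠ using (-1*x≈-x; -‿distribˡ-*; +-inverseʳ-unique)
  open import Relation.Binary.Reasoning.Setoid ≈-setoid as ≈-Reasoning using ()

  Vec : ℕ → Set c
  Vec = V F

  decode-injective : ∀ n {k k′ : Fin (order ^ n)} → decode {n} k ≋ decode k′ → k ≡ k′
  decode-injective n {k} {k′} eq =
    trans (sym (Fin.funToFin-finToFin {n} k)) (trans (funToFin-cong (λ i →
      trans (sym (Inverse.strictlyInverseˡ enumeration (finToFun k i)))
      (trans (Inverse.to-cong enumeration (eq i))
             (Inverse.strictlyInverseˡ enumeration (finToFun k′ i)))))
      (Fin.funToFin-finToFin {n} k′))

  -- Vectors are summed through their codes because `Vec n` carries a setoid equality; up to `≋`
  -- each vector has exactly one code.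
  sumᵛ : ∀ {n} → (Vec n → ℤ) → ℤ
  sumᵛ {n} f = sum {order ^ n} (λ k → f (decode k))

  sumᵛ-unique : ∀ {n p} {P : Pred (Vec n) p} (P? : Decidable P) → P Respects _≋_ →
                ∀ x → P x → (∀ y → P y → x ≋ y) → sumᵛ (λ y → indicator (P? y)) ≡ 1ℤ
  sumᵛ-unique {n} P? resp x Px x! = indicator-unique {n = order ^ n} (yes tt) (λ k → P? (decode k))
    (λ _ → encode x , resp (≋-sym (decode-encode x)) Px) (λ _ → tt)
    (λ {i} {j} Pi Pj → decode-injective n (≋-trans (≋-sym (x! (decode i) Pi)) (x! (decode j) Pj)))

  sumᵛ-zero : ∀ n → sumᵛ {n} (λ x → indicator (x ≋? 0ᵛ)) ≡ 1ℤ
  sumᵛ-zero n = sumᵛ-unique {n} {P = _≋ 0ᵛ} (_≋? 0ᵛ)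
    (λ x≋y x≈0 → ≋-trans (≋-sym x≋y) x≈0) 0ᵛ ≋-refl (λ _ y≈0 → ≋-sym y≈0)

  scale : ∀ {n} a (x : Vec n) → ¬ x ≋ 0ᵛ → a *ᵛ x ≋ 0ᵛ → a ≈ 0#
  scale a x x≉0 ax≈0 = decidable-stable (LinearAlgebra._≟_ F a 0#) λ a≉0 → x≉0 λ i →
    let a⁻¹ , aa⁻¹≈1 = invertible a a≉0 in begin
    x i                     ≈⟨ *-identityˡ (x i) ⟨
    1# *ᶠ x i               ≈⟨ *-congʳ aa⁻¹≈1 ⟨
    (a *ᶠ a⁻¹) *ᶠ x i       ≈⟨ *-congʳ (*-comm a a⁻¹) ⟩
    (a⁻¹ *ᶠ a) *ᶠ x i       ≈⟨ *-assoc a⁻¹ a (x i) ⟩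
    a⁻¹ *ᶠ (a *ᶠ x i)       ≈⟨ *-congˡ (ax≈0 i) ⟩
    a⁻¹ *ᶠ 0#               ≈⟨ zeroʳ a⁻¹ ⟩
    0#                      ∎
    where open ≈-Reasoning

  coordinates-injective : ∀ {n j} {b : Vector (Vec n) j} → LinearlyIndependent b → ∀ a a′ →
                          linearCombination a b ≋ linearCombination a′ b → a ≋ a′
  coordinates-injective {n} {j} {b} ind a a′ eq s = begin
    a s                             ≈⟨ +-identityʳ (a s) ⟨
    a s +ᶠ 0#                       ≈⟨ +-congˡ (-‿inverseˡ (a′ s)) ⟨
    a s +ᶠ (-ᶠ a′ s +ᶠ a′ s)        ≈⟨ +-assoc (a s) (-ᶠ a′ s) (a′ s) ⟨
    (a s +ᶠ -ᶠ a′ s) +ᶠ a′ s        ≈⟨ +-congʳ (+-congˡ (-1*x≈-x (a′ s))) ⟨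
    (a s +ᶠ -ᶠ 1# *ᶠ a′ s) +ᶠ a′ s  ≈⟨ +-congʳ (ind (proj₁ difference) difference≈0 s) ⟩
    0# +ᶠ a′ s                      ≈⟨ +-identityˡ (a′ s) ⟩
    a′ s                            ∎
    where
    open ≈-Reasoning
    x = linearCombination a b
    x′ = linearCombination a′ b

    -- The closure proofs of `span b` carry coefficients: `proj₁ difference s` computes to
    -- `a s +ᶠ -ᶠ 1# *ᶠ a′ s`.
    difference : (x +ᵛ (-ᶠ 1#) *ᵛ x′) ∈ span b
    difference = Subspace.+-closed (span b) {x} {(-ᶠ 1#) *ᵛ x′} (a , ≋-refl)
                   (Subspace.*-closed (span b) (-ᶠ 1#) {x′} (a′ , ≋-refl))

    difference≈0 : linearCombination (proj₁ difference) b ≋ 0ᵛ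
    difference≈0 i = ≈-trans (proj₂ difference i)
      (≈-trans (+-cong (eq i) (-1*x≈-x (x′ i))) (-‿inverseʳ (x′ i)))

  -- Double count of pairs of a coefficient vector and its combination: independence and spanning
  -- give each vector of `U` exactly one coefficient vector. `U?` is arbitrary so that the result
  -- fits whichever decision procedure occurs in a sum.
  cardinality : ∀ {n j} (U : Subspace F n) → Basis F U j → (U? : ∀ x → Dec (x ∈ U)) →
                sumᵛ (λ x → indicator (U? x)) ≡ (+ order) ℤ.^ j
  cardinality {n} {j} U B U? = begin
    sumᵛ (λ x → indicator (U? x))
      ≡⟨ sum-cong-≗ (λ k → sym (indicator-unique {n = order ^ j} (U? (decode k)) (λ a → hit? a (decode k))
           (λ x∈U → let a , a≋ = B.spanning (decode k) x∈U in encode a ,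
              ≋-trans (linearCombination-cong (decode-encode a) (λ _ → ≋-refl)) a≋)
           (λ {a} hit → Subspace.resp U hit (linearCombination∈ U (decode a) B.vector∈))
           (λ {a} {a′} hit hit′ → decode-injective j (coordinates-injective B.independent (decode a) (decode a′)
              (≋-trans hit (≋-sym hit′)))))) ⟩
    sum (λ k → sum (λ a → indicator (hit? a (decode k))))
      ≡⟨ ∑-comm (λ k a → indicator (hit? a (decode k))) ⟩
    sum (λ a → sumᵛ (λ x → indicator (hit? a x)))
      ≡⟨ sum-cong-≗ (λ a → sumᵛ-unique (hit? a) (λ x≋y hit → ≋-trans hit x≋y) (combination a) ≋-refl (λ _ hit → hit)) ⟩
    sum {order ^ j} (λ _ → 1ℤ)
      ≡⟨ sum-const (order ^ j) 1ℤ ⟩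
    + (order ^ j) ℤ.* 1ℤ ≡⟨ ℤ.*-identityʳ _ ⟩
    + (order ^ j) ≡⟨ pos-^ order j ⟩
    (+ order) ℤ.^ j ∎
    where
    open ≡-Reasoning
    module B = Basis B
    combination : Fin (order ^ j) → Vec n
    combination a = linearCombination (decode a) B.vector
    hit? : ∀ a x → Dec (combination a ≋ x)
    hit? a x = combination a ≋? x

  -- `h` is the number of nonzero vectors representing one projective point.
  q h : ℤ
  q = + order
  h = q ℤ.- 1ℤ

  1<order : 1 < order
  1<order = distinct⇒1< (Inverse.to enumeration 0#) (Inverse.to enumeration 1#)
    λ eq → 0≉1 (≈-trans (≈-sym (Inverse.strictlyInverseʳ enumeration 0#))
                 (≈-trans (Inverse.from-cong enumeration eq) (Inverse.strictlyInverseʳ enumeration 1#)))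
    where
    distinct⇒1< : ∀ {n} (i j : Fin n) → i ≢ j → 1 < n
    distinct⇒1< {1} Fin.zero Fin.zero i≢j = contradiction refl i≢j
    distinct⇒1< {suc (suc n)} _ _ _ = ℕ.s≤s (ℕ.s≤s ℕ.z≤n)

  instance
    q≢0 : ℤ.NonZero q
    q≢0 = ℕ.>-nonZero (ℕ.<-trans (ℕ.s≤s ℕ.z≤n) 1<order)

    q+1≢0 : ℤ.NonZero (q ℤ.+ 1ℤ)
    q+1≢0 = ℕ.>-nonZero (ℕ.m≤n+m 1 order)

    h≢0 : ℤ.NonZero h
    h≢0 = ℤ.≢-nonZero λ h≡0 → ℕ.<⇒≢ 1<order (sym (ℤ.+-injective (ℤ.i-j≡0⇒i≡j q 1ℤ h≡0)))

  Nonzero : ∀ {n} → Vec n → Set ℓ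
  Nonzero x = ¬ x ≋ 0ᵛ

  nonzero? : ∀ {n} (x : Vec n) → Dec (Nonzero x)
  nonzero? x = ¬? (x ≋? 0ᵛ)

  Nonzero-resp : ∀ {n} → Nonzero {n} Respects _≋_
  Nonzero-resp x≋y x≉0 y≈0 = x≉0 (≋-trans x≋y y≈0)

  sumᵛ-nonzero : ∀ {n j} (U : Subspace F n) → Basis F U j → (U? : ∀ x → Dec (x ∈ U)) →
                 sumᵛ (λ x → indicator (U? x ×-dec nonzero? x)) ≡ q ℤ.^ j ℤ.- 1ℤ
  sumᵛ-nonzero {n} {j} U B U? = begin
    sumᵛ (λ x → indicator (U? x ×-dec nonzero? x))
      ≡⟨ sum-cong-≗ (λ k → indicator-×-¬ (U? (decode k)) (decode k ≋? 0ᵛ)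
           (λ x≈0 → Subspace.resp U {0ᵛ} {decode k} (≋-sym x≈0) (Subspace.0-closed U))) ⟩
    sumᵛ (λ x → indicator (U? x) ℤ.- indicator (x ≋? 0ᵛ))
      ≡⟨ sum-difference {order ^ n} (λ k → indicator (U? (decode k))) (λ k → indicator (decode {n} k ≋? 0ᵛ)) ⟩
    sumᵛ (λ x → indicator (U? x)) ℤ.- sumᵛ {n} (λ x → indicator (x ≋? 0ᵛ))
      ≡⟨ cong₂ ℤ._-_ (cardinality U B U?)
           (sumᵛ-zero n) ⟩
    q ℤ.^ j ℤ.- 1ℤ ∎
    where open ≡-Reasoning

  -- Rays and planes spanned by vectors

  ray : ∀ {n} → Vec n → Subspace F n
  ray x = span {j = 1} (λ _ → x)

  ray? : ∀ {n} (x y : Vec n) → Dec (y ∈ ray x)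
  ray? x y = ∃? {n = 1} {P = λ a → linearCombination a (λ _ → x) ≋ y}
    (λ {a} {a′} a≋a′ a≋ → ≋-trans
      (linearCombination-cong {a = a′} {a} {λ _ → x} {λ _ → x} (≋-sym a≋a′) (λ _ → ≋-refl)) a≋)
    (λ a → linearCombination a (λ _ → x) ≋? y)

  multiple∈ray : ∀ {n} {x y : Vec n} a → a *ᵛ x ≋ y → y ∈ ray x
  multiple∈ray {x = x} a ax≋y = (λ _ → a) , λ i → ≈-trans (+-identityʳ (a *ᶠ x i)) (ax≋y i)

  ∈ray⇒multiple : ∀ {n} {x y : Vec n} → y ∈ ray x → ∃[ a ] a *ᵛ x ≋ y
  ∈ray⇒multiple {x = x} (a , a≋) = a Fin.zero , λ i → ≈-trans (≈-sym (+-identityʳ (a Fin.zero *ᶠ x i))) (a≋ i)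

  rayBasis : ∀ {n} {x : Vec n} → Nonzero x → Basis F (ray x) 1
  rayBasis {x = x} x≉0 = spanBasis {b = λ _ → x} λ { a eq Fin.zero →
    scale (a Fin.zero) x x≉0 (λ i → ≈-trans (≈-sym (+-identityʳ (a Fin.zero *ᶠ x i))) (eq i)) }

  ray⊆ : ∀ {n} (U : Subspace F n) {x} → x ∈ U → ray x ⊆ U
  ray⊆ U x∈U = span⊆ U (λ _ → x∈U)

  unscale∈ : ∀ {n} (U : Subspace F n) {x} a → ¬ a ≈ 0# → (a *ᵛ x) ∈ U → x ∈ U
  unscale∈ U {x} a a≉0 ax∈U = let a⁻¹ , aa⁻¹≈1 = invertible a a≉0 in
    Subspace.resp U (λ i → begin
      a⁻¹ *ᶠ (a *ᶠ x i) ≈⟨ *-assoc a⁻¹ a (x i) ⟨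
      (a⁻¹ *ᶠ a) *ᶠ x i ≈⟨ *-congʳ (*-comm a⁻¹ a) ⟩
      (a *ᶠ a⁻¹) *ᶠ x i ≈⟨ *-congʳ aa⁻¹≈1 ⟩
      1# *ᶠ x i         ≈⟨ *-identityˡ (x i) ⟩
      x i ∎) (Subspace.*-closed U a⁻¹ ax∈U)
    where open ≈-Reasoning

  ray-sym : ∀ {n} {x y : Vec n} → Nonzero y → y ∈ ray x → x ∈ ray y
  ray-sym {x = x} {y} y≉0 y∈ =
    let a , ax≋y = ∈ray⇒multiple y∈ in
    unscale∈ (ray y) a
      (λ a≈0 → y≉0 λ i → ≈-trans (≈-sym (ax≋y i)) (≈-trans (*-congʳ a≈0) (zeroˡ (x i))))
      (multiple∈ray 1# λ i → ≈-trans (*-identityˡ (y i)) (≈-sym (ax≋y i)))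

  ∉ray⇒Nonzero : ∀ {n} {x y : Vec n} → ¬ y ∈ ray x → Nonzero y
  ∉ray⇒Nonzero {x = x} y∉ y≈0 = y∉ (Subspace.resp (ray x) (≋-sym y≈0) (Subspace.0-closed (ray x)))

  pair : ∀ {n} → Vec n → Vec n → Vector (Vec n) 2
  pair x y Fin.zero    = x
  pair x y (Fin.suc _) = y

  pair∈ : ∀ {n} (U : Subspace F n) {x y} → x ∈ U → y ∈ U → ∀ s → pair x y s ∈ U
  pair∈ U x∈U y∈U Fin.zero    = x∈U
  pair∈ U x∈U y∈U (Fin.suc _) = y∈U

  pair-independent : ∀ {n} {x y : Vec n} → Nonzero x → ¬ y ∈ ray x → LinearlyIndependent (pair x y)
  pair-independent {n} {x} {y} x≉0 y∉ a eq = λ where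
      Fin.zero           → a₀≈0
      (Fin.suc Fin.zero) → a₁≈0
    where
    open ≈-Reasoning
    a₀ = a Fin.zero
    a₁ = a (Fin.suc Fin.zero)

    a₁≈0 : a₁ ≈ 0#
    a₁≈0 = decidable-stable (LinearAlgebra._≟_ F a₁ 0#) λ a₁≉0 → y∉ (unscale∈ (ray x) a₁ a₁≉0
      (multiple∈ray (-ᶠ a₀) λ i → begin
        (-ᶠ a₀) *ᶠ x i   ≈⟨ -‿distribˡ-* a₀ (x i) ⟨
        -ᶠ (a₀ *ᶠ x i)   ≈⟨ +-inverseʳ-unique _ _ (eq i) ⟨
        a₁ *ᶠ y i +ᶠ 0#  ≈⟨ +-identityʳ _ ⟩
        a₁ *ᶠ y i ∎))

    a₀≈0 : a₀ ≈ 0#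
    a₀≈0 = scale a₀ x x≉0 λ i → begin
      a₀ *ᶠ x i                          ≈⟨ +-identityʳ _ ⟨
      a₀ *ᶠ x i +ᶠ 0#                    ≈⟨ +-congˡ (zeroˡ (y i)) ⟨
      a₀ *ᶠ x i +ᶠ 0# *ᶠ y i             ≈⟨ +-congˡ (*-congʳ a₁≈0) ⟨
      a₀ *ᶠ x i +ᶠ a₁ *ᶠ y i             ≈⟨ +-congˡ (+-identityʳ _) ⟨
      a₀ *ᶠ x i +ᶠ (a₁ *ᶠ y i +ᶠ 0#)     ≈⟨ eq i ⟩
      0# ∎

  -- Equal dimension means equal cardinality, so the vectors of `U` outside `W` number zero.
  -- Counting replaces an exchange argument.
  ⊆-reverse : ∀ {n j} {U W : Subspace F n} → Basis F U j → Basis F W j → W ⊆ U → U ⊆ W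
  ⊆-reverse {n} {j} {U} {W} B C W⊆U = go (member? U B) (member? W C)
    where
    open ≡-Reasoning
    go : (∀ x → Dec (x ∈ U)) → (∀ x → Dec (x ∈ W)) → U ⊆ W
    go U? W? z z∈U = decidable-stable (W? z) λ z∉W →
      sum-indicator-zero {order ^ n} {P = λ k → decode k ∈ U × ¬ decode k ∈ W}
        (λ k → outside? (decode k)) none (encode z)
        ( Subspace.resp U (≋-sym (decode-encode z)) z∈U
        , z∉W ∘ Subspace.resp W (decode-encode z) )
      where
      outside? : ∀ z → Dec (z ∈ U × ¬ z ∈ W)
      outside? z = U? z ×-dec ¬? (W? z)

      none : sumᵛ (λ z → indicator (outside? z)) ≡ 0ℤ
      none = begin
        sumᵛ (λ z → indicator (outside? z))
          ≡⟨ sum-cong-≗ {order ^ n} (λ k → indicator-×-¬ (U? (decode k)) (W? (decode k)) (W⊆U (decode k))) ⟩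
        sumᵛ (λ z → indicator (U? z) ℤ.- indicator (W? z))
          ≡⟨ sum-difference {order ^ n} (λ k → indicator (U? (decode k))) (λ k → indicator (W? (decode k))) ⟩
        sumᵛ (λ z → indicator (U? z)) ℤ.- sumᵛ (λ z → indicator (W? z))
          ≡⟨ cong₂ ℤ._-_ (cardinality U B U?) (cardinality W C W?) ⟩
        q ℤ.^ j ℤ.- q ℤ.^ j
          ≡⟨ ℤ.+-inverseʳ (q ℤ.^ j) ⟩
        0ℤ ∎

  line⊆plane : ∀ {n} {U : Subspace F n} → Basis F U 2 → ∀ {x y} → x ∈ U → y ∈ U →
               Nonzero x → ¬ y ∈ ray x → U ⊆ span (pair x y)
  line⊆plane {U = U} B {x} {y} x∈U y∈U x≉0 y∉ =
    ⊆-reverse {U = U} {span (pair x y)} B (spanBasis {b = pair x y} (pair-independent x≉0 y∉))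
              (span⊆ U {pair x y} (pair∈ U x∈U y∈U))

  -- Incidence between lines and nonzero vectors

  module Lines {n N} (vertices : Inverse (Grassmannian F n 2) (setoid (Fin N))) where
    open Inverse vertices using (to; from)

    line : Fin N → Subspace F n
    line i = proj₁ (from i)

    line? : ∀ i x → Dec (x ∈ line i)
    line? i = member? (line i) (proj₂ (from i))

    on? : ∀ i x → Dec (x ∈ line i × Nonzero x)
    on? i x = line? i x ×-dec nonzero? x

    on : Fin N → Vec n → ℤ
    on i x = indicator (on? i x)

    sum-on : ∀ i → sumᵛ (on i) ≡ q ℤ.^ 2 ℤ.- 1ℤ
    sum-on i = sumᵛ-nonzero (line i) (proj₂ (from i)) (line? i)

    line-≡ : ∀ {i j} → line i ⊆ line j → line j ⊆ line i → i ≡ j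
    line-≡ {i} {j} i⊆j j⊆i = trans (sym (Inverse.strictlyInverseˡ vertices i))
      (trans (Inverse.to-cong vertices (i⊆j , j⊆i)) (Inverse.strictlyInverseˡ vertices j))

    line-unique : ∀ {x y i j} → Nonzero x → ¬ y ∈ ray x → x ∈ line i → y ∈ line i →
                  x ∈ line j → y ∈ line j → i ≡ j
    line-unique {x} {y} {i} {j} x≉0 y∉ x∈i y∈i x∈j y∈j = line-≡
      (λ z z∈ → span⊆ (line j) {pair x y} (pair∈ (line j) x∈j y∈j) z (line⊆plane (proj₂ (from i)) x∈i y∈i x≉0 y∉ z z∈))
      (λ z z∈ → span⊆ (line i) {pair x y} (pair∈ (line i) x∈i y∈i) z (line⊆plane (proj₂ (from j)) x∈j y∈j x≉0 y∉ z z∈))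

    -- Two independent vectors lie on exactly one line, the vertex representing their span.
    sum-on-on : ∀ {x y} → Nonzero x → ¬ y ∈ ray x → sum (λ i → on i x ℤ.* on i y) ≡ 1ℤ
    sum-on-on {x} {y} x≉0 y∉ = trans
      (sum-cong-≗ (λ i → sym (indicator-× (on? i x) (on? i y))))
      (indicator-unique {P = λ i → (x ∈ line i × Nonzero x) × (y ∈ line i × Nonzero y)} (yes tt) (λ i → on? i x ×-dec on? i y)
        (λ _ → to plane , (plane⊆ x (Basis.vector∈ (proj₂ plane) Fin.zero) , x≉0)
                        , (plane⊆ y (Basis.vector∈ (proj₂ plane) (Fin.suc Fin.zero)) , ∉ray⇒Nonzero y∉))
        (λ _ → tt)
        (λ ((x∈i , _) , (y∈i , _)) ((x∈j , _) , (y∈j , _)) → line-unique x≉0 y∉ x∈i y∈i x∈j y∈j))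
      where
      plane : Σ (Subspace F n) (λ U → Basis F U 2)
      plane = span (pair x y) , spanBasis {b = pair x y} (pair-independent x≉0 y∉)
      plane⊆ : span (pair x y) ⊆ line (to plane)
      plane⊆ = proj₂ (Inverse.strictlyInverseʳ vertices plane)

    on-ray : ∀ {x y} i → Nonzero x → Nonzero y → y ∈ ray x → on i y ≡ on i x
    on-ray {x} {y} i x≉0 y≉0 y∈ = indicator-cong (on? i y) (on? i x)
      (λ (y∈i , _) → ray⊆ (line i) y∈i x (ray-sym y≉0 y∈) , x≉0)
      (λ (x∈i , _) → ray⊆ (line i) x∈i y y∈ , y≉0)

    sum-on-line : ∀ {x} → Nonzero x → ∀ i → x ∈ line i →
                  sumᵛ (λ y → indicator (¬? (ray? x y)) ℤ.* on i y) ≡ q ℤ.* h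
    sum-on-line {x} x≉0 i x∈i = begin
      sumᵛ (λ y → indicator (¬? (ray? x y)) ℤ.* on i y)
        ≡⟨ sum-cong-≗ (λ k → pointwise (decode k)) ⟩
      sumᵛ (λ y → indicator (line? i y) ℤ.- indicator (ray? x y))
        ≡⟨ sum-difference {order ^ n} (λ k → indicator (line? i (decode k))) (λ k → indicator (ray? x (decode k))) ⟩
      sumᵛ (λ y → indicator (line? i y)) ℤ.- sumᵛ (λ y → indicator (ray? x y))
        ≡⟨ cong₂ ℤ._-_ (cardinality (line i) (proj₂ (from i)) (line? i)) (cardinality (ray x) (rayBasis x≉0) (ray? x)) ⟩
      q ℤ.^ 2 ℤ.- q ℤ.^ 1
        ≡⟨ lem q ⟩
      q ℤ.* h ∎
      where
      open ≡-Reasoning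
      lem : ∀ q → q ℤ.* (q ℤ.* 1ℤ) ℤ.- q ℤ.* 1ℤ ≡ q ℤ.* (q ℤ.- 1ℤ)
      lem = solve-∀
      pointwise : ∀ y → indicator (¬? (ray? x y)) ℤ.* on i y ≡ indicator (line? i y) ℤ.- indicator (ray? x y)
      pointwise y = trans (sym (indicator-× (¬? (ray? x y)) (on? i y)))
        (trans (indicator-cong (¬? (ray? x y) ×-dec on? i y) (line? i y ×-dec ¬? (ray? x y))
                 (λ (y∉ , y∈i , _) → y∈i , y∉) (λ (y∈i , y∉) → y∉ , y∈i , ∉ray⇒Nonzero {x = x} y∉))
               (indicator-×-¬ (line? i y) (ray? x y) (ray⊆ (line i) {x} x∈i y)))

    -- Double count of pairs of a line through `x` and a vector `y` on it off the ray of `x`: each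
    -- line has `q ^ 2 - q` such vectors, and each `y` off the ray determines one line.
    degree-equation : ∀ {x} → Nonzero x → sum (λ i → on i x) ℤ.* (q ℤ.* h) ≡ q ℤ.^ n ℤ.- q
    degree-equation {x} x≉0 = begin
      sum (λ i → on i x) ℤ.* (q ℤ.* h)
        ≡⟨ *-distribʳ-sum (q ℤ.* h) (λ i → on i x) ⟩
      sum (λ i → on i x ℤ.* (q ℤ.* h))
        ≡⟨ sum-cong-≗ (λ i → indicator-*-cong (on? i x) (λ (x∈i , _) → sym (sum-on-line x≉0 i x∈i))) ⟩
      sum (λ i → on i x ℤ.* sumᵛ (λ y → outside y ℤ.* on i y))
        ≡⟨ sum-cong-≗ (λ i → *-distribˡ-sum (on i x) (λ k → outside (decode k) ℤ.* on i (decode k))) ⟩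
      sum (λ i → sumᵛ (λ y → on i x ℤ.* (outside y ℤ.* on i y)))
        ≡⟨ ∑-comm (λ i k → on i x ℤ.* (outside (decode k) ℤ.* on i (decode k))) ⟩
      sumᵛ (λ y → sum (λ i → on i x ℤ.* (outside y ℤ.* on i y)))
        ≡⟨ sum-cong-≗ (λ k → pointwise (decode k)) ⟩
      sumᵛ (λ y → 1ℤ ℤ.- indicator (ray? x y))
        ≡⟨ sum-difference {order ^ n} (λ _ → 1ℤ) (λ k → indicator (ray? x (decode k))) ⟩
      sum {order ^ n} (λ _ → 1ℤ) ℤ.- sumᵛ (λ y → indicator (ray? x y))
        ≡⟨ cong₂ ℤ._-_ (trans (sum-const (order ^ n) 1ℤ) (trans (ℤ.*-identityʳ _) (pos-^ order n)))
                       (trans (cardinality (ray x) (rayBasis x≉0) (ray? x)) (ℤ.*-identityʳ q)) ⟩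
      q ℤ.^ n ℤ.- q ∎
      where
      open ≡-Reasoning
      outside : Vec n → ℤ
      outside y = indicator (¬? (ray? x y))
      swap : ∀ a b c → a ℤ.* (b ℤ.* c) ≡ b ℤ.* (a ℤ.* c)
      swap = solve-∀
      pointwise : ∀ y → sum (λ i → on i x ℤ.* (outside y ℤ.* on i y)) ≡ 1ℤ ℤ.- indicator (ray? x y)
      pointwise y = begin
        sum (λ i → on i x ℤ.* (outside y ℤ.* on i y))
          ≡⟨ sum-cong-≗ (λ i → swap (on i x) (outside y) (on i y)) ⟩
        sum (λ i → outside y ℤ.* (on i x ℤ.* on i y))
          ≡⟨ sym (*-distribˡ-sum (outside y) (λ i → on i x ℤ.* on i y)) ⟩
        outside y ℤ.* sum (λ i → on i x ℤ.* on i y)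
          ≡⟨ indicator-*-cong (¬? (ray? x y)) (λ y∉ → sum-on-on x≉0 y∉) ⟩
        outside y ℤ.* 1ℤ
          ≡⟨ ℤ.*-identityʳ (outside y) ⟩
        outside y
          ≡⟨ indicator-¬ (ray? x y) ⟩
        1ℤ ℤ.- indicator (ray? x y) ∎

    -- The incidence matrix and the matrix of common points

    on-zero : ∀ {x} i → x ≋ 0ᵛ → on i x ≡ 0ℤ
    on-zero {x} i x≈0 = indicator-false (on? i x) (λ (_ , x≉0) → x≉0 x≈0)

    on-idempotent : ∀ i x → on i x ℤ.* on i x ≡ on i x
    on-idempotent i x = trans (indicator-*-cong (on? i x) (λ x∈ → indicator-true (on? i x) x∈)) (ℤ.*-identityʳ _)

    -- The matrix `B` of the overview. Its columns are indexed by the codes of all vectors, and the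
    -- column of the zero vector vanishes; this is where the factors `nonzero k` below originate.
    incidence : Matrix N (order ^ n)
    incidence i k = on i (decode k)

    incidenceᵀ : Matrix (order ^ n) N
    incidenceᵀ k i = incidence i k

    concurrence : Matrix N N
    concurrence = incidence ⊗ incidenceᵀ

    basis-nonzero : ∀ {U : Subspace F n} {j} (B : Basis F U (suc j)) → Nonzero (Basis.vector B Fin.zero)
    basis-nonzero B b≈0 = 0≉1 (≈-sym (Basis.independent B (δ Fin.zero)
      (≋-trans (linearCombination-δ (Basis.vector B) Fin.zero) b≈0) Fin.zero))

    -- A witness can be extracted from the negated statement because the search over all vectors is
    -- finite.
    commonPoint : ∀ i j → ¬ TrivialIntersection F (line i) (line j) →
                  ∃[ x ] (x ∈ line i × x ∈ line j) × Nonzero x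
    commonPoint i j ¬trivial = decidable-stable
      (∃? {n} {P = λ x → (x ∈ line i × x ∈ line j) × Nonzero x}
        (λ x≋y ((x∈i , x∈j) , x≉0) →
          (Subspace.resp (line i) x≋y x∈i , Subspace.resp (line j) x≋y x∈j) , Nonzero-resp x≋y x≉0)
        (λ x → (line? i x ×-dec line? j x) ×-dec nonzero? x))
      (λ none → ¬trivial λ x x∈i x∈j → decidable-stable (x ≋? 0ᵛ) λ x≉0 → none (x , (x∈i , x∈j) , x≉0))

    -- Skew lines share no nonzero vector, lines meeting in a point share `h`, and a line shares
    -- `q ^ 2 - 1 = h (q + 1)` with itself. The decisions are arguments so that their indicators
    -- become, by computation, the entries of the adjacency and identity matrices.
    concurrence-≡ : ∀ i j (d : Dec (TrivialIntersection F (line i) (line j))) (e : Dec (i ≡ j)) →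
                    concurrence i j ≡ h ℤ.* (1ℤ ℤ.- indicator d ℤ.+ q ℤ.* indicator e)
    concurrence-≡ i j (yes trivial) (yes refl) =
      contradiction (trivial _ (Basis.vector∈ B Fin.zero) (Basis.vector∈ B Fin.zero)) (basis-nonzero B)
      where B = proj₂ (from i)
    concurrence-≡ i j (yes trivial) (no _) = trans
      (sum-zero (λ k → trans (sym (indicator-× (on? i (decode k)) (on? j (decode k))))
        (indicator-false (on? i (decode k) ×-dec on? j (decode k))
          (λ ((x∈i , x≉0) , (x∈j , _)) → x≉0 (trivial (decode k) x∈i x∈j)))))
      (lem q)
      where
      lem : ∀ q → 0ℤ ≡ (q ℤ.- 1ℤ) ℤ.* (1ℤ ℤ.- 1ℤ ℤ.+ q ℤ.* 0ℤ)
      lem = solve-∀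
    concurrence-≡ i j (no _) (yes refl) = trans
      (sum-cong-≗ (λ k → on-idempotent i (decode k)))
      (trans (sum-on i) (lem q))
      where
      lem : ∀ q → q ℤ.* (q ℤ.* 1ℤ) ℤ.- 1ℤ ≡ (q ℤ.- 1ℤ) ℤ.* (1ℤ ℤ.- 0ℤ ℤ.+ q ℤ.* 1ℤ)
      lem = solve-∀
    -- A common vector off the ray of `x` would force `i ≡ j`, so the common vectors are exactly
    -- those of the ray.
    concurrence-≡ i j (no ¬trivial) (no i≢j) =
      let x , (x∈i , x∈j) , x≉0 = commonPoint i j ¬trivial in trans
      (sum-cong-≗ (λ k → trans
        (sym (indicator-× (on? i (decode k)) (on? j (decode k))))
        (indicator-cong (on? i (decode k) ×-dec on? j (decode k)) (ray? x (decode k) ×-dec nonzero? (decode k))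
          (λ ((y∈i , y≉0) , (y∈j , _)) →
            decidable-stable (ray? x (decode k)) (λ y∉ → i≢j (line-unique x≉0 y∉ x∈i y∈i x∈j y∈j)) , y≉0)
          (λ (y∈ , y≉0) → (ray⊆ (line i) {x} x∈i (decode k) y∈ , y≉0) , (ray⊆ (line j) {x} x∈j (decode k) y∈ , y≉0)))))
      (trans (sumᵛ-nonzero (ray x) (rayBasis x≉0) (ray? x)) (lem q))
      where
      lem : ∀ q → q ℤ.* 1ℤ ℤ.- 1ℤ ≡ (q ℤ.- 1ℤ) ℤ.* (1ℤ ℤ.- 0ℤ ℤ.+ q ℤ.* 0ℤ)
      lem = solve-∀

    -- `r` is the number of lines through a point, specified by an equation instead of a quotient.
    -- Geometric sums solve the equation in both dimensions where the module is used.
    module Degree (r : ℤ) (r-equation : r ℤ.* (q ℤ.* h) ≡ q ℤ.^ n ℤ.- q) where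

      degree : ∀ {x} → Nonzero x → sum (λ i → on i x) ≡ r
      degree {x} x≉0 = ℤ.*-cancelʳ-≡ (sum (λ i → on i x)) r (q ℤ.* h) {{ℤ.i*j≢0 q h}}
        (trans (degree-equation x≉0) (sym r-equation))

      nonzero : Fin (order ^ n) → ℤ
      nonzero k = indicator (nonzero? {n} (decode k))

      degree′ : ∀ k → sum (λ i → incidence i k) ≡ nonzero k ℤ.* r
      degree′ k = go (decode {n} k ≋? 0ᵛ)
        where
        go : (d : Dec (decode {n} k ≋ 0ᵛ)) → sum (λ i → incidence i k) ≡ indicator (¬? d) ℤ.* r
        go (yes x≈0) = sum-zero (λ i → on-zero i x≈0)
        go (no x≉0)  = trans (degree x≉0) (sym (ℤ.*-identityˡ r))

      nonzero-on : ∀ i k → nonzero k ℤ.* incidence i k ≡ incidence i k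
      nonzero-on i k = go (decode {n} k ≋? 0ᵛ)
        where
        go : (d : Dec (decode {n} k ≋ 0ᵛ)) → indicator (¬? d) ℤ.* incidence i k ≡ incidence i k
        go (yes x≈0) = sym (on-zero i x≈0)
        go (no x≉0)  = ℤ.*-identityˡ (incidence i k)

      sum-nonzero : sum nonzero ≡ q ℤ.^ n ℤ.- 1ℤ
      sum-nonzero = begin
        sum nonzero
          ≡⟨ sum-cong-≗ {order ^ n} (λ k → indicator-¬ (decode {n} k ≋? 0ᵛ)) ⟩
        sum (λ k → 1ℤ ℤ.- indicator (decode {n} k ≋? 0ᵛ))
          ≡⟨ sum-difference {order ^ n} (λ _ → 1ℤ) (λ k → indicator (decode {n} k ≋? 0ᵛ)) ⟩
        sum {order ^ n} (λ _ → 1ℤ) ℤ.- sumᵛ {n} (λ x → indicator (x ≋? 0ᵛ))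
          ≡⟨ cong₂ ℤ._-_ (trans (sum-const (order ^ n) 1ℤ) (trans (ℤ.*-identityʳ _) (pos-^ order n)))
               (sumᵛ-zero n) ⟩
        q ℤ.^ n ℤ.- 1ℤ ∎
        where open ≡-Reasoning

      -- Double count of incident pairs, by lines and by vectors.
      lineCount : + N ℤ.* (q ℤ.^ 2 ℤ.- 1ℤ) ≡ (q ℤ.^ n ℤ.- 1ℤ) ℤ.* r
      lineCount = begin
        + N ℤ.* (q ℤ.^ 2 ℤ.- 1ℤ)                ≡⟨ sum-const N (q ℤ.^ 2 ℤ.- 1ℤ) ⟨
        sum {N} (λ _ → q ℤ.^ 2 ℤ.- 1ℤ)          ≡⟨ sum-cong-≗ sum-on ⟨
        sum (λ i → sum (λ k → incidence i k))   ≡⟨ ∑-comm incidence ⟩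
        sum (λ k → sum (λ i → incidence i k))   ≡⟨ sum-cong-≗ degree′ ⟩
        sum (λ k → nonzero k ℤ.* r)             ≡⟨ *-distribʳ-sum r nonzero ⟨
        sum nonzero ℤ.* r                       ≡⟨ cong (ℤ._* r) sum-nonzero ⟩
        (q ℤ.^ n ℤ.- 1ℤ) ℤ.* r ∎
        where open ≡-Reasoning

      rowSum : ∀ i → (concurrence · (λ _ → 1ℤ)) i ≡ (q ℤ.^ 2 ℤ.- 1ℤ) ℤ.* r
      rowSum i = begin
        (concurrence · (λ _ → 1ℤ)) i
          ≡⟨ ·-assoc incidence incidenceᵀ (λ _ → 1ℤ) i ⟩
        sum (λ k → incidence i k ℤ.* sum (λ j → incidence j k ℤ.* 1ℤ))
          ≡⟨ sum-cong-≗ (λ k → cong (incidence i k ℤ.*_)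
               (trans (sum-cong-≗ (λ j → ℤ.*-identityʳ (incidence j k))) (degree′ k))) ⟩
        sum (λ k → incidence i k ℤ.* (nonzero k ℤ.* r))
          ≡⟨ sum-cong-≗ (λ k → trans (lem (incidence i k) (nonzero k) r) (cong (ℤ._* r) (nonzero-on i k))) ⟩
        sum (λ k → incidence i k ℤ.* r)
          ≡⟨ *-distribʳ-sum r (incidence i) ⟨
        sum (incidence i) ℤ.* r
          ≡⟨ cong (ℤ._* r) (sum-on i) ⟩
        (q ℤ.^ 2 ℤ.- 1ℤ) ℤ.* r ∎
        where
        open ≡-Reasoning
        lem : ∀ a b r → a ℤ.* (b ℤ.* r) ≡ b ℤ.* a ℤ.* r
        lem = solve-∀

      gram : Matrix (order ^ n) (order ^ n)
      gram = incidenceᵀ ⊗ incidence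

      -- Vectors on one ray share all `r` lines through it; independent vectors share a single line.
      gram-≡ : ∀ k k′ → Nonzero {n} (decode k) → Nonzero {n} (decode k′) →
               gram k k′ ≡ 1ℤ ℤ.+ (r ℤ.- 1ℤ) ℤ.* indicator (ray? {n} (decode k′) (decode k))
      gram-≡ k k′ x≉0 x′≉0 = go (ray? (decode k′) (decode k))
        where
        lem₁ : ∀ r → r ≡ 1ℤ ℤ.+ (r ℤ.- 1ℤ) ℤ.* 1ℤ
        lem₁ = solve-∀
        lem₀ : ∀ r → 1ℤ ≡ 1ℤ ℤ.+ (r ℤ.- 1ℤ) ℤ.* 0ℤ
        lem₀ = solve-∀
        go : (d : Dec (decode k ∈ ray (decode k′))) → gram k k′ ≡ 1ℤ ℤ.+ (r ℤ.- 1ℤ) ℤ.* indicator d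
        go (yes x∈) = trans (sum-cong-≗ (λ i → trans (cong (ℤ._* incidence i k′) (on-ray i x′≉0 x≉0 x∈))
                                                     (on-idempotent i (decode k′))))
                            (trans (degree x′≉0) (lem₁ r))
        go (no x∉) = trans (sum-cong-≗ (λ i → ℤ.*-comm (incidence i k) (incidence i k′)))
                           (trans (sum-on-on x′≉0 x∉) (lem₀ r))

      -- By `gram-≡`, on nonzero vectors `Bᵀ B` is the all-ones matrix plus `r - 1` times the
      -- same-ray relation. The first part sums a row of `B`, giving `q ^ 2 - 1`; the second
      -- multiplies `B` by `h`, since a line contains a ray entirely or misses its nonzero vectors.
      incidence-gram : ∀ i k′ → (incidence ⊗ gram) i k′ ≡
                       (q ℤ.^ 2 ℤ.- 1ℤ) ℤ.* nonzero k′ ℤ.+ (r ℤ.- 1ℤ) ℤ.* h ℤ.* incidence i k′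
      incidence-gram i k′ = go (decode {n} k′ ≋? 0ᵛ)
        where
        go : (d : Dec (decode {n} k′ ≋ 0ᵛ)) → (incidence ⊗ gram) i k′ ≡
             (q ℤ.^ 2 ℤ.- 1ℤ) ℤ.* indicator (¬? d) ℤ.+ (r ℤ.- 1ℤ) ℤ.* h ℤ.* incidence i k′
        go (yes x′≈0) = begin
          sum (λ k → incidence i k ℤ.* gram k k′)
            ≡⟨ sum-zero (λ k → trans (cong (incidence i k ℤ.*_) (sum-zero (λ j →
                 trans (cong (incidence j k ℤ.*_) (on-zero j x′≈0)) (ℤ.*-zeroʳ (incidence j k)))))
                 (ℤ.*-zeroʳ (incidence i k))) ⟩
          0ℤ
            ≡⟨ lem (q ℤ.^ 2 ℤ.- 1ℤ) ((r ℤ.- 1ℤ) ℤ.* h) ⟩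
          (q ℤ.^ 2 ℤ.- 1ℤ) ℤ.* 0ℤ ℤ.+ (r ℤ.- 1ℤ) ℤ.* h ℤ.* 0ℤ
            ≡⟨ cong (λ z → (q ℤ.^ 2 ℤ.- 1ℤ) ℤ.* 0ℤ ℤ.+ (r ℤ.- 1ℤ) ℤ.* h ℤ.* z) (on-zero i x′≈0) ⟨
          (q ℤ.^ 2 ℤ.- 1ℤ) ℤ.* 0ℤ ℤ.+ (r ℤ.- 1ℤ) ℤ.* h ℤ.* incidence i k′ ∎
          where
          open ≡-Reasoning
          lem : ∀ a b → 0ℤ ≡ a ℤ.* 0ℤ ℤ.+ b ℤ.* 0ℤ
          lem = solve-∀
        go (no x′≉0) = begin
          sum (λ k → incidence i k ℤ.* gram k k′)
            ≡⟨ sum-cong-≗ {order ^ n} (λ k → pointwise k) ⟩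
          sum (λ k → incidence i k ℤ.+ (r ℤ.- 1ℤ) ℤ.* (incidence i k′ ℤ.* onRay k))
            ≡⟨ ∑-distrib-+ (incidence i) (λ k → (r ℤ.- 1ℤ) ℤ.* (incidence i k′ ℤ.* onRay k)) ⟩
          sum (incidence i) ℤ.+ sum (λ k → (r ℤ.- 1ℤ) ℤ.* (incidence i k′ ℤ.* onRay k))
            ≡⟨ cong₂ ℤ._+_ (sum-on i) (trans
                 (sym (*-distribˡ-sum (r ℤ.- 1ℤ) (λ k → incidence i k′ ℤ.* onRay k)))
                 (cong ((r ℤ.- 1ℤ) ℤ.*_) (trans
                   (sym (*-distribˡ-sum (incidence i k′) onRay))
                   (cong (incidence i k′ ℤ.*_) (sumᵛ-nonzero (ray x′) (rayBasis x′≉0) (ray? x′)))))) ⟩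
          (q ℤ.^ 2 ℤ.- 1ℤ) ℤ.+ (r ℤ.- 1ℤ) ℤ.* (incidence i k′ ℤ.* (q ℤ.^ 1 ℤ.- 1ℤ))
            ≡⟨ lem q r (incidence i k′) ⟩
          (q ℤ.^ 2 ℤ.- 1ℤ) ℤ.* 1ℤ ℤ.+ (r ℤ.- 1ℤ) ℤ.* h ℤ.* incidence i k′ ∎
          where
          open ≡-Reasoning
          x′ : Vec n
          x′ = decode k′
          onRay : Vector ℤ (order ^ n)
          onRay k = indicator (ray? x′ (decode k) ×-dec nonzero? (decode {n} k))
          lem : ∀ q r b → (q ℤ.* (q ℤ.* 1ℤ) ℤ.- 1ℤ) ℤ.+ (r ℤ.- 1ℤ) ℤ.* (b ℤ.* (q ℤ.* 1ℤ ℤ.- 1ℤ)) ≡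
                          (q ℤ.* (q ℤ.* 1ℤ) ℤ.- 1ℤ) ℤ.* 1ℤ ℤ.+ (r ℤ.- 1ℤ) ℤ.* (q ℤ.- 1ℤ) ℤ.* b
          lem = solve-∀
          lem′ : ∀ a r d → a ℤ.* (1ℤ ℤ.+ (r ℤ.- 1ℤ) ℤ.* d) ≡ a ℤ.+ (r ℤ.- 1ℤ) ℤ.* (d ℤ.* a)
          lem′ = solve-∀
          -- Incidence is constant along a ray, so the condition on `x` moves to the fixed `x′`.
          -- What remains to be summed is the indicator of the nonzero vectors of a single ray.
          transfer : ∀ x → indicator (ray? x′ x) ℤ.* on i x ≡ on i x′ ℤ.* indicator (ray? x′ x ×-dec nonzero? x)
          transfer x = begin
            indicator (ray? x′ x) ℤ.* on i x
              ≡⟨ sym (indicator-× (ray? x′ x) (on? i x)) ⟩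
            indicator (ray? x′ x ×-dec on? i x)
              ≡⟨ indicator-cong (ray? x′ x ×-dec on? i x) (on? i x′ ×-dec (ray? x′ x ×-dec nonzero? x))
                   (λ (x∈ , x∈i , x≉0) → (ray⊆ (line i) {x} x∈i x′ (ray-sym x≉0 x∈) , x′≉0) , x∈ , x≉0)
                   (λ ((x′∈i , _) , x∈ , x≉0) → x∈ , ray⊆ (line i) {x′} x′∈i x x∈ , x≉0) ⟩
            indicator (on? i x′ ×-dec (ray? x′ x ×-dec nonzero? x))
              ≡⟨ indicator-× (on? i x′) (ray? x′ x ×-dec nonzero? x) ⟩
            on i x′ ℤ.* indicator (ray? x′ x ×-dec nonzero? x) ∎
          pointwise : ∀ k → incidence i k ℤ.* gram k k′ ≡
                            incidence i k ℤ.+ (r ℤ.- 1ℤ) ℤ.* (incidence i k′ ℤ.* onRay k)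
          pointwise k = begin
            incidence i k ℤ.* gram k k′
              ≡⟨ indicator-*-cong (on? i (decode k)) (λ (_ , x≉0) → gram-≡ k k′ x≉0 x′≉0) ⟩
            incidence i k ℤ.* (1ℤ ℤ.+ (r ℤ.- 1ℤ) ℤ.* indicator (ray? x′ (decode k)))
              ≡⟨ lem′ (incidence i k) r (indicator (ray? x′ (decode k))) ⟩
            incidence i k ℤ.+ (r ℤ.- 1ℤ) ℤ.* (indicator (ray? x′ (decode k)) ℤ.* incidence i k)
              ≡⟨ cong (λ z → incidence i k ℤ.+ (r ℤ.- 1ℤ) ℤ.* z) (transfer (decode k)) ⟩
            incidence i k ℤ.+ (r ℤ.- 1ℤ) ℤ.* (incidence i k′ ℤ.* onRay k) ∎

      -- Regrouping `C C` as `(B (Bᵀ B)) Bᵀ` brings in `incidence-gram`. One factor `q ^ 2 - 1`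
      -- comes from there, the other from summing `Bᵀ z` over all vectors.
      concurrence² : ∀ z i → (concurrence · concurrence · z) i ≡
                     (q ℤ.^ 2 ℤ.- 1ℤ) ℤ.* (q ℤ.^ 2 ℤ.- 1ℤ) ℤ.* sum z ℤ.+ (r ℤ.- 1ℤ) ℤ.* h ℤ.* (concurrence · z) i
      concurrence² z i = begin
        (concurrence · concurrence · z) i
          ≡⟨ ·-cong concurrence (·-assoc incidence incidenceᵀ z) i ⟩
        (concurrence · incidence · y) i
          ≡⟨ ·-assoc incidence incidenceᵀ (incidence · y) i ⟩
        (incidence · incidenceᵀ · incidence · y) i
          ≡⟨ ·-cong incidence (λ k → sym (·-assoc incidenceᵀ incidence y k)) i ⟩
        (incidence · gram · y) i
          ≡⟨ sym (·-assoc incidence gram y i) ⟩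
        sum (λ k → (incidence ⊗ gram) i k ℤ.* y k)
          ≡⟨ sum-cong-≗ (λ k → trans (cong (ℤ._* y k) (incidence-gram i k)) (lem γ (nonzero k) β (incidence i k) (y k))) ⟩
        sum (λ k → γ ℤ.* (nonzero k ℤ.* y k) ℤ.+ β ℤ.* (incidence i k ℤ.* y k))
          ≡⟨ ∑-distrib-+ (λ k → γ ℤ.* (nonzero k ℤ.* y k)) (λ k → β ℤ.* (incidence i k ℤ.* y k)) ⟩
        sum (λ k → γ ℤ.* (nonzero k ℤ.* y k)) ℤ.+ sum (λ k → β ℤ.* (incidence i k ℤ.* y k))
          ≡⟨ cong₂ ℤ._+_ (sym (*-distribˡ-sum γ (λ k → nonzero k ℤ.* y k)))
                         (sym (*-distribˡ-sum β (λ k → incidence i k ℤ.* y k))) ⟩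
        γ ℤ.* sum (λ k → nonzero k ℤ.* y k) ℤ.+ β ℤ.* (incidence · y) i
          ≡⟨ cong₂ (λ a b → γ ℤ.* a ℤ.+ β ℤ.* b) total (sym (·-assoc incidence incidenceᵀ z i)) ⟩
        γ ℤ.* (γ ℤ.* sum z) ℤ.+ β ℤ.* (concurrence · z) i
          ≡⟨ cong₂ ℤ._+_ (sym (ℤ.*-assoc γ γ (sum z))) refl ⟩
        γ ℤ.* γ ℤ.* sum z ℤ.+ β ℤ.* (concurrence · z) i ∎
        where
        open ≡-Reasoning
        γ β : ℤ
        γ = q ℤ.^ 2 ℤ.- 1ℤ
        β = (r ℤ.- 1ℤ) ℤ.* h
        y : Vector ℤ (order ^ n)
        y = incidenceᵀ · z
        lem : ∀ γ n β b y → (γ ℤ.* n ℤ.+ β ℤ.* b) ℤ.* y ≡ γ ℤ.* (n ℤ.* y) ℤ.+ β ℤ.* (b ℤ.* y)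
        lem = solve-∀
        total : sum (λ k → nonzero k ℤ.* y k) ≡ γ ℤ.* sum z
        total = begin
          sum (λ k → nonzero k ℤ.* y k)
            ≡⟨ sum-cong-≗ (λ k → *-distribˡ-sum (nonzero k) (λ j → incidence j k ℤ.* z j)) ⟩
          sum (λ k → sum (λ j → nonzero k ℤ.* (incidence j k ℤ.* z j)))
            ≡⟨ sum-cong-≗ (λ k → sum-cong-≗ (λ j → trans (sym (ℤ.*-assoc (nonzero k) (incidence j k) (z j)))
                                                         (cong (ℤ._* z j) (nonzero-on j k)))) ⟩
          sum (λ k → sum (λ j → incidence j k ℤ.* z j))
            ≡⟨ ∑-comm (λ k j → incidence j k ℤ.* z j) ⟩
          sum (λ j → sum (λ k → incidence j k ℤ.* z j))
            ≡⟨ sum-cong-≗ (λ j → trans (sym (*-distribʳ-sum (z j) (incidence j))) (cong (ℤ._* z j) (sum-on j))) ⟩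
          sum (λ j → γ ℤ.* z j)
            ≡⟨ *-distribˡ-sum γ z ⟨
          γ ℤ.* sum z ∎

-- The Laplacian of the skew-lines graph

geometric : ℤ → ℕ → ℤ
geometric q zero    = 0ℤ
geometric q (suc m) = 1ℤ ℤ.+ q ℤ.* geometric q m

geometric-sum : ∀ q m → (q ℤ.- 1ℤ) ℤ.* geometric q m ≡ q ℤ.^ m ℤ.- 1ℤ
geometric-sum q zero    = ℤ.*-zeroʳ (q ℤ.- 1ℤ)
geometric-sum q (suc m) = begin
  (q ℤ.- 1ℤ) ℤ.* (1ℤ ℤ.+ q ℤ.* g)                   ≡⟨ lem₁ q g ⟩
  (q ℤ.- 1ℤ) ℤ.+ q ℤ.* ((q ℤ.- 1ℤ) ℤ.* g)           ≡⟨ cong (λ z → (q ℤ.- 1ℤ) ℤ.+ q ℤ.* z) (geometric-sum q m) ⟩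
  (q ℤ.- 1ℤ) ℤ.+ q ℤ.* (q ℤ.^ m ℤ.- 1ℤ)             ≡⟨ lem₂ q (q ℤ.^ m) ⟩
  q ℤ.* q ℤ.^ m ℤ.- 1ℤ ∎
  where
  open ≡-Reasoning
  g = geometric q m
  lem₁ : ∀ q g → (q ℤ.- 1ℤ) ℤ.* (1ℤ ℤ.+ q ℤ.* g) ≡ (q ℤ.- 1ℤ) ℤ.+ q ℤ.* ((q ℤ.- 1ℤ) ℤ.* g)
  lem₁ = solve-∀
  lem₂ : ∀ q u → (q ℤ.- 1ℤ) ℤ.+ q ℤ.* (u ℤ.- 1ℤ) ≡ q ℤ.* u ℤ.- 1ℤ
  lem₂ = solve-∀

geometric-degree : ∀ q m → geometric q m ℤ.* (q ℤ.* (q ℤ.- 1ℤ)) ≡ q ℤ.^ suc m ℤ.- q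
geometric-degree q m = trans (lem₁ q (geometric q m))
  (trans (cong (q ℤ.*_) (geometric-sum q m)) (lem₂ q (q ℤ.^ m)))
  where
  lem₁ : ∀ q g → g ℤ.* (q ℤ.* (q ℤ.- 1ℤ)) ≡ q ℤ.* ((q ℤ.- 1ℤ) ℤ.* g)
  lem₁ = solve-∀
  lem₂ : ∀ q u → q ℤ.* (u ℤ.- 1ℤ) ≡ q ℤ.* u ℤ.- q
  lem₂ = solve-∀

·-affine : ∀ {m n} (M : Matrix m n) (x y : Vector ℤ n) a b i →
           (M · (λ j → a ℤ.* x j ℤ.+ b ℤ.+ y j)) i ≡
           a ℤ.* (M · x) i ℤ.+ b ℤ.* (M · (λ _ → 1ℤ)) i ℤ.+ (M · y) i
·-affine M x y a b i = begin
  sum (λ j → M i j ℤ.* (a ℤ.* x j ℤ.+ b ℤ.+ y j))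
    ≡⟨ sum-cong-≗ (λ j → lem (M i j) a (x j) b (y j)) ⟩
  sum (λ j → a ℤ.* (M i j ℤ.* x j) ℤ.+ b ℤ.* (M i j ℤ.* 1ℤ) ℤ.+ M i j ℤ.* y j)
    ≡⟨ ∑-distrib-+ (λ j → a ℤ.* (M i j ℤ.* x j) ℤ.+ b ℤ.* (M i j ℤ.* 1ℤ)) (λ j → M i j ℤ.* y j) ⟩
  sum (λ j → a ℤ.* (M i j ℤ.* x j) ℤ.+ b ℤ.* (M i j ℤ.* 1ℤ)) ℤ.+ (M · y) i
    ≡⟨ cong (ℤ._+ (M · y) i) (∑-distrib-+ (λ j → a ℤ.* (M i j ℤ.* x j)) (λ j → b ℤ.* (M i j ℤ.* 1ℤ))) ⟩
  sum (λ j → a ℤ.* (M i j ℤ.* x j)) ℤ.+ sum (λ j → b ℤ.* (M i j ℤ.* 1ℤ)) ℤ.+ (M · y) i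
    ≡⟨ cong (ℤ._+ (M · y) i) (cong₂ ℤ._+_ (sym (*-distribˡ-sum a (λ j → M i j ℤ.* x j)))
                                         (sym (*-distribˡ-sum b (λ j → M i j ℤ.* 1ℤ)))) ⟩
  a ℤ.* (M · x) i ℤ.+ b ℤ.* (M · (λ _ → 1ℤ)) i ℤ.+ (M · y) i ∎
  where
  open ≡-Reasoning
  lem : ∀ m a x b y → m ℤ.* (a ℤ.* x ℤ.+ b ℤ.+ y) ≡ a ℤ.* (m ℤ.* x) ℤ.+ b ℤ.* (m ℤ.* 1ℤ) ℤ.+ m ℤ.* y
  lem = solve-∀

-- v and v′ count the lines of F^(4+m) and of F^(2+m), u = q ^ m, and a is
-- a row sum of the adjacency matrix.
regularity : ∀ {q u v v′ r r′ a} .{{_ : ℤ.NonZero q}} .{{_ : ℤ.NonZero (q ℤ.- 1ℤ)}} .{{_ : ℤ.NonZero (q ℤ.+ 1ℤ)}} →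
  r ℤ.* (q ℤ.* (q ℤ.- 1ℤ)) ≡ q ℤ.* (q ℤ.* (q ℤ.* (q ℤ.* u))) ℤ.- q →
  v ℤ.* (q ℤ.* (q ℤ.* 1ℤ) ℤ.- 1ℤ) ≡ (q ℤ.* (q ℤ.* (q ℤ.* (q ℤ.* u))) ℤ.- 1ℤ) ℤ.* r →
  r′ ℤ.* (q ℤ.* (q ℤ.- 1ℤ)) ≡ q ℤ.* (q ℤ.* u) ℤ.- q →
  v′ ℤ.* (q ℤ.* (q ℤ.* 1ℤ) ℤ.- 1ℤ) ≡ (q ℤ.* (q ℤ.* u) ℤ.- 1ℤ) ℤ.* r′ →
  (q ℤ.* (q ℤ.* 1ℤ) ℤ.- 1ℤ) ℤ.* r ≡ (q ℤ.- 1ℤ) ℤ.* (v ℤ.- a ℤ.+ q) →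
  a ≡ q ℤ.* (q ℤ.* (q ℤ.* (q ℤ.* 1ℤ))) ℤ.* v′
regularity {q} {u} {v} {v′} {r} {r′} {a} r≡ v≡ r′≡ v′≡ a≡ =
  ℤ.*-cancelˡ-≡ factor a (q⁴ ℤ.* v′) {{factor≢0}} (begin
    factor ℤ.* a
      ≡⟨ lem₁ q v a ⟩
    (q ℤ.* h) ℤ.* (h ℤ.* (v ℤ.* c) ℤ.+ h ℤ.* q ℤ.* c ℤ.- c ℤ.* (h ℤ.* (v ℤ.- a ℤ.+ q)))
      ≡⟨ cong₂ (λ y z → (q ℤ.* h) ℤ.* (h ℤ.* y ℤ.+ h ℤ.* q ℤ.* c ℤ.- c ℤ.* z)) v≡ (sym a≡) ⟩
    (q ℤ.* h) ℤ.* (h ℤ.* ((q⁴u ℤ.- 1ℤ) ℤ.* r) ℤ.+ h ℤ.* q ℤ.* c ℤ.- c ℤ.* (c ℤ.* r))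
      ≡⟨ lem₂ q q⁴u r ⟩
    (h ℤ.* (q⁴u ℤ.- 1ℤ) ℤ.- c ℤ.* c) ℤ.* (r ℤ.* (q ℤ.* h)) ℤ.+ (q ℤ.* h) ℤ.* (h ℤ.* q ℤ.* c)
      ≡⟨ cong (λ y → (h ℤ.* (q⁴u ℤ.- 1ℤ) ℤ.- c ℤ.* c) ℤ.* y ℤ.+ (q ℤ.* h) ℤ.* (h ℤ.* q ℤ.* c)) r≡ ⟩
    (h ℤ.* (q⁴u ℤ.- 1ℤ) ℤ.- c ℤ.* c) ℤ.* (q⁴u ℤ.- q) ℤ.+ (q ℤ.* h) ℤ.* (h ℤ.* q ℤ.* c)
      ≡⟨ lem₃ q u ⟩
    h ℤ.* q⁴ ℤ.* ((q²u ℤ.- 1ℤ) ℤ.* (q²u ℤ.- q))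
      ≡⟨ cong (λ y → h ℤ.* q⁴ ℤ.* ((q²u ℤ.- 1ℤ) ℤ.* y)) (sym r′≡) ⟩
    h ℤ.* q⁴ ℤ.* ((q²u ℤ.- 1ℤ) ℤ.* (r′ ℤ.* (q ℤ.* h)))
      ≡⟨ lem₄ (h ℤ.* q⁴) (q²u ℤ.- 1ℤ) r′ (q ℤ.* h) ⟩
    h ℤ.* q⁴ ℤ.* ((q²u ℤ.- 1ℤ) ℤ.* r′ ℤ.* (q ℤ.* h))
      ≡⟨ cong (λ y → h ℤ.* q⁴ ℤ.* (y ℤ.* (q ℤ.* h))) (sym v′≡) ⟩
    h ℤ.* q⁴ ℤ.* (v′ ℤ.* c ℤ.* (q ℤ.* h))
      ≡⟨ lem₅ q v′ ⟩
    factor ℤ.* (q⁴ ℤ.* v′) ∎)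
  where
  open ≡-Reasoning
  h c q⁴ q²u q⁴u factor : ℤ
  h = q ℤ.- 1ℤ
  c = q ℤ.* (q ℤ.* 1ℤ) ℤ.- 1ℤ
  q⁴ = q ℤ.* (q ℤ.* (q ℤ.* (q ℤ.* 1ℤ)))
  q²u = q ℤ.* (q ℤ.* u)
  q⁴u = q ℤ.* (q ℤ.* (q ℤ.* (q ℤ.* u)))
  -- This is `q h` times `h c`, with `c = h (q + 1)` split into visibly nonzero factors: `q h`
  -- clears the denominators of `r` and `r′`, `c` those of `v` and `v′`, and `h` that of the row
  -- sum.
  factor = (q ℤ.* h) ℤ.* (h ℤ.* h ℤ.* (q ℤ.+ 1ℤ))
  factor≢0 : ℤ.NonZero factor
  factor≢0 = ℤ.i*j≢0 (q ℤ.* h) (h ℤ.* h ℤ.* (q ℤ.+ 1ℤ))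
    {{ℤ.i*j≢0 q h}} {{ℤ.i*j≢0 (h ℤ.* h) (q ℤ.+ 1ℤ) {{ℤ.i*j≢0 h h}}}}
  lem₁ : ∀ q v a → let h = q ℤ.- 1ℤ; c = q ℤ.* (q ℤ.* 1ℤ) ℤ.- 1ℤ in
    (q ℤ.* h) ℤ.* (h ℤ.* h ℤ.* (q ℤ.+ 1ℤ)) ℤ.* a ≡
    (q ℤ.* h) ℤ.* (h ℤ.* (v ℤ.* c) ℤ.+ h ℤ.* q ℤ.* c ℤ.- c ℤ.* (h ℤ.* (v ℤ.- a ℤ.+ q)))
  lem₁ = solve-∀
  lem₂ : ∀ q w r → let h = q ℤ.- 1ℤ; c = q ℤ.* (q ℤ.* 1ℤ) ℤ.- 1ℤ in
    (q ℤ.* h) ℤ.* (h ℤ.* ((w ℤ.- 1ℤ) ℤ.* r) ℤ.+ h ℤ.* q ℤ.* c ℤ.- c ℤ.* (c ℤ.* r)) ≡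
    (h ℤ.* (w ℤ.- 1ℤ) ℤ.- c ℤ.* c) ℤ.* (r ℤ.* (q ℤ.* h)) ℤ.+ (q ℤ.* h) ℤ.* (h ℤ.* q ℤ.* c)
  lem₂ = solve-∀
  -- The substance of the count: the lines skew to a given one become `q ^ 4` times the lines of a
  -- space of dimension two less.
  lem₃ : ∀ q u → let h = q ℤ.- 1ℤ; c = q ℤ.* (q ℤ.* 1ℤ) ℤ.- 1ℤ; w = q ℤ.* (q ℤ.* (q ℤ.* (q ℤ.* u))) in
    (h ℤ.* (w ℤ.- 1ℤ) ℤ.- c ℤ.* c) ℤ.* (w ℤ.- q) ℤ.+ (q ℤ.* h) ℤ.* (h ℤ.* q ℤ.* c) ≡
    h ℤ.* (q ℤ.* (q ℤ.* (q ℤ.* (q ℤ.* 1ℤ)))) ℤ.* ((q ℤ.* (q ℤ.* u) ℤ.- 1ℤ) ℤ.* (q ℤ.* (q ℤ.* u) ℤ.- q))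
  lem₃ = solve-∀
  lem₄ : ∀ a b r e → a ℤ.* (b ℤ.* (r ℤ.* e)) ≡ a ℤ.* (b ℤ.* r ℤ.* e)
  lem₄ = solve-∀
  lem₅ : ∀ q v → let h = q ℤ.- 1ℤ; c = q ℤ.* (q ℤ.* 1ℤ) ℤ.- 1ℤ; q⁴ = q ℤ.* (q ℤ.* (q ℤ.* (q ℤ.* 1ℤ))) in
    h ℤ.* q⁴ ℤ.* (v ℤ.* c ℤ.* (q ℤ.* h)) ≡ (q ℤ.* h) ℤ.* (h ℤ.* h ℤ.* (q ℤ.+ 1ℤ)) ℤ.* (q⁴ ℤ.* v)
  lem₅ = solve-∀

-- The product of the two nonzero eigenvalues of (q - 1) L is - q ^ 3 modulo q ^ 4.
eigenvalueProduct : ∀ {q u v′ r} → (q ℤ.- 1ℤ) ℤ.* r ≡ q ℤ.* (q ℤ.* (q ℤ.* u)) ℤ.- 1ℤ →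
  let f = (q ℤ.- 1ℤ) ℤ.* (q ℤ.* (q ℤ.* (q ℤ.* (q ℤ.* 1ℤ))) ℤ.* v′ ℤ.- q)
      β = (r ℤ.- 1ℤ) ℤ.* (q ℤ.- 1ℤ) in
  ∃[ y ] (f ℤ.+ β) ℤ.* f ≡ q ℤ.* (q ℤ.* (q ℤ.* (q ℤ.* y ℤ.- 1ℤ)))
eigenvalueProduct {q} {u} {v′} {r} r≡ = y , trans
  (cong (λ z → (f ℤ.+ z) ℤ.* f) (trans (lem₁ q r) (cong (ℤ._- (q ℤ.- 1ℤ)) r≡)))
  (lem₂ q u v′)
  where
  f y : ℤ
  f = (q ℤ.- 1ℤ) ℤ.* (q ℤ.* (q ℤ.* (q ℤ.* (q ℤ.* 1ℤ))) ℤ.* v′ ℤ.- q)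
  -- In terms of `a` and `b`, `f = h q (q a - 1)` and `f + β = q ^ 2 (q b - 1)`. The witness solves
  -- `q y - 1 = (q - 1) (q a - 1) (q b - 1)`.
  y = (q ℤ.* a ℤ.- 1ℤ) ℤ.* (q ℤ.* b ℤ.- 1ℤ) ℤ.- q ℤ.* a ℤ.* b ℤ.+ a ℤ.+ b
    where
    a b : ℤ
    a = q ℤ.* q ℤ.* v′
    b = (q ℤ.- 1ℤ) ℤ.* q ℤ.* v′ ℤ.+ u
  lem₁ : ∀ q r → (r ℤ.- 1ℤ) ℤ.* (q ℤ.- 1ℤ) ≡ (q ℤ.- 1ℤ) ℤ.* r ℤ.- (q ℤ.- 1ℤ)
  lem₁ = solve-∀
  lem₂ : ∀ q u v →
    let f = (q ℤ.- 1ℤ) ℤ.* (q ℤ.* (q ℤ.* (q ℤ.* (q ℤ.* 1ℤ))) ℤ.* v ℤ.- q)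
        a = q ℤ.* q ℤ.* v
        b = (q ℤ.- 1ℤ) ℤ.* q ℤ.* v ℤ.+ u
        y = (q ℤ.* a ℤ.- 1ℤ) ℤ.* (q ℤ.* b ℤ.- 1ℤ) ℤ.- q ℤ.* a ℤ.* b ℤ.+ a ℤ.+ b in
    (f ℤ.+ (q ℤ.* (q ℤ.* (q ℤ.* u)) ℤ.- 1ℤ ℤ.- (q ℤ.- 1ℤ))) ℤ.* f ≡
    q ℤ.* (q ℤ.* (q ℤ.* (q ℤ.* y ℤ.- 1ℤ)))
  lem₂ = solve-∀

-- With the dimension written as `4 + m`, the subtraction in the valency computes to `2 + m` and the
-- powers of `q` unfold to the nested products in `regularity` and `eigenvalueProduct`.
module Laplacian {c ℓ} (F : FiniteField c ℓ) (m : ℕ) {N}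
                 (vertices : Inverse (Grassmannian F (4 ℕ.+ m) 2) (setoid (Fin N))) where
  open Counting F
  open Lines vertices

  open FiniteField F using (order)
  open Degree (geometric q (3 ℕ.+ m)) (geometric-degree q (3 ℕ.+ m)) using (lineCount; rowSum; concurrence²)

  r v′ k : ℤ
  r  = geometric q (3 ℕ.+ m)
  v′ = + gaussianBinomial F (2 ℕ.+ m) 2
  k  = + SkewLines.valency F (4 ℕ.+ m)

  A L : Matrix N N
  A = SkewLines.adjacency F (4 ℕ.+ m) vertices
  L = SkewLines.laplacian F (4 ℕ.+ m) vertices

  k≡ : k ≡ q ℤ.^ 4 ℤ.* v′
  k≡ = trans (ℤ.pos-* (order ^ 4) (gaussianBinomial F (2 ℕ.+ m) 2)) (cong (ℤ._* v′) (pos-^ order 4))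

  -- `gaussianBinomial` is by definition the length of an enumeration of lines, so the double count
  -- applies to that enumeration.
  quotientLineCount : v′ ℤ.* (q ℤ.^ 2 ℤ.- 1ℤ) ≡ (q ℤ.^ (2 ℕ.+ m) ℤ.- 1ℤ) ℤ.* geometric q (1 ℕ.+ m)
  quotientLineCount = Lines.Degree.lineCount (proj₂ (LinearAlgebra.grassmannianFinite F (2 ℕ.+ m) 2))
    (geometric q (1 ℕ.+ m)) (geometric-degree q (1 ℕ.+ m))

  concurrence-· : ∀ x i → (concurrence · x) i ≡ h ℤ.* (sum x ℤ.- (A · x) i ℤ.+ q ℤ.* x i)
  concurrence-· x i = begin
    sum (λ j → concurrence i j ℤ.* x j)
      ≡⟨ sum-cong-≗ (λ j → trans
           (cong (ℤ._* x j) (concurrence-≡ i j (SkewLines.adjacent? F (4 ℕ.+ m) (from i) (from j)) (i Fin.≟ j)))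
           (lem h (A i j) q (identity i j) (x j))) ⟩
    sum (λ j → h ℤ.* (x j ℤ.- A i j ℤ.* x j ℤ.+ q ℤ.* (identity i j ℤ.* x j)))
      ≡⟨ sym (*-distribˡ-sum h (λ j → x j ℤ.- A i j ℤ.* x j ℤ.+ q ℤ.* (identity i j ℤ.* x j))) ⟩
    h ℤ.* sum (λ j → x j ℤ.- A i j ℤ.* x j ℤ.+ q ℤ.* (identity i j ℤ.* x j))
      ≡⟨ cong (h ℤ.*_) (∑-distrib-+ (λ j → x j ℤ.- A i j ℤ.* x j) (λ j → q ℤ.* (identity i j ℤ.* x j))) ⟩
    h ℤ.* (sum (λ j → x j ℤ.- A i j ℤ.* x j) ℤ.+ sum (λ j → q ℤ.* (identity i j ℤ.* x j)))
      ≡⟨ cong (h ℤ.*_) (cong₂ ℤ._+_ (sum-difference x (λ j → A i j ℤ.* x j))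
           (trans (sym (*-distribˡ-sum q (λ j → identity i j ℤ.* x j))) (cong (q ℤ.*_) (identity-· x i)))) ⟩
    h ℤ.* (sum x ℤ.- (A · x) i ℤ.+ q ℤ.* x i) ∎
    where
    open ≡-Reasoning
    open Inverse vertices using (from)
    lem : ∀ h a q e x → h ℤ.* (1ℤ ℤ.- a ℤ.+ q ℤ.* e) ℤ.* x ≡ h ℤ.* (x ℤ.- a ℤ.* x ℤ.+ q ℤ.* (e ℤ.* x))
    lem = solve-∀

  laplacian-· : ∀ x i → (L · x) i ≡ k ℤ.* x i ℤ.- (A · x) i
  laplacian-· x i = begin
    sum (λ j → (k ℤ.* identity i j ℤ.- A i j) ℤ.* x j)
      ≡⟨ sum-cong-≗ (λ j → lem k (identity i j) (A i j) (x j)) ⟩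
    sum (λ j → k ℤ.* (identity i j ℤ.* x j) ℤ.- A i j ℤ.* x j)
      ≡⟨ sum-difference (λ j → k ℤ.* (identity i j ℤ.* x j)) (λ j → A i j ℤ.* x j) ⟩
    sum (λ j → k ℤ.* (identity i j ℤ.* x j)) ℤ.- (A · x) i
      ≡⟨ cong (ℤ._- (A · x) i) (trans (sym (*-distribˡ-sum k (λ j → identity i j ℤ.* x j)))
                                      (cong (k ℤ.*_) (identity-· x i))) ⟩
    k ℤ.* x i ℤ.- (A · x) i ∎
    where
    open ≡-Reasoning
    lem : ∀ k e a x → (k ℤ.* e ℤ.- a) ℤ.* x ≡ k ℤ.* (e ℤ.* x) ℤ.- a ℤ.* x
    lem = solve-∀

  -- The row sum of `C` is computed twice, from incidences and from `h (J - A + q I)`; comparison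
  -- determines the row sum of `A`.
  adjacency-regular : ∀ i → (A · (λ _ → 1ℤ)) i ≡ k
  adjacency-regular i = trans
    (regularity {q} {q ℤ.^ m} {+ N} {v′} {r} {geometric q (1 ℕ.+ m)}
      (geometric-degree q (3 ℕ.+ m)) lineCount (geometric-degree q (1 ℕ.+ m)) quotientLineCount
      (trans (sym (rowSum i)) (trans (concurrence-· (λ _ → 1ℤ) i)
        (cong₂ (λ y z → h ℤ.* (y ℤ.- (A · (λ _ → 1ℤ)) i ℤ.+ z))
          (trans (sum-const N 1ℤ) (ℤ.*-identityʳ (+ N))) (ℤ.*-identityʳ q)))))
    (sym k≡)

  L1≡0 : ∀ i → (L · (λ _ → 1ℤ)) i ≡ 0ℤ
  L1≡0 i = trans (laplacian-· (λ _ → 1ℤ) i)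
    (trans (cong₂ ℤ._-_ (ℤ.*-identityʳ k) (adjacency-regular i)) (ℤ.+-inverseʳ k))

  f β : ℤ
  f = h ℤ.* (k ℤ.- q)
  β = (r ℤ.- 1ℤ) ℤ.* h

  scaled-laplacian : ∀ x i → h ℤ.* (L · x) i ≡ f ℤ.* x i ℤ.+ ℤ.- (h ℤ.* sum x) ℤ.+ (concurrence · x) i
  scaled-laplacian x i = trans (cong (h ℤ.*_) (laplacian-· x i))
    (trans (lem h k q (x i) ((A · x) i) (sum x)) (cong (λ z → f ℤ.* x i ℤ.+ ℤ.- (h ℤ.* sum x) ℤ.+ z) (sym (concurrence-· x i))))
    where
    lem : ∀ h k q x a s → h ℤ.* (k ℤ.* x ℤ.- a) ≡
          h ℤ.* (k ℤ.- q) ℤ.* x ℤ.+ ℤ.- (h ℤ.* s) ℤ.+ h ℤ.* (s ℤ.- a ℤ.+ q ℤ.* x)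
    lem = solve-∀

  reduce : ∀ a x → (∀ i → a ℤ.∣ (L · x) i) → ∃[ c ] ∀ i → a ℤ.∣ (f ℤ.+ β) ℤ.* f ℤ.* x i ℤ.+ c
  -- `y` is `h L x`, to which `(f + β) I - C` is applied. The constant collects the contributions of
  -- `J`: `b` comes from `- h J`, `b (γ r)` from `C` acting on the constant vector `b`, and
  -- `γ γ (sum x)` from the square of `C`.
  reduce a x a∣Lx = (f ℤ.+ β) ℤ.* b ℤ.- b ℤ.* (γ ℤ.* r) ℤ.- γ ℤ.* γ ℤ.* sum x , λ i →
    ∣-resp (eq i) (ℤ.∣m∣n⇒∣m-n (ℤ.∣n⇒∣m*n (f ℤ.+ β) (a∣y i)) (∣-· concurrence a∣y i))
    where
    open ≡-Reasoning
    b γ : ℤ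
    b = ℤ.- (h ℤ.* sum x)
    γ = q ℤ.^ 2 ℤ.- 1ℤ
    y : Vector ℤ N
    y j = f ℤ.* x j ℤ.+ b ℤ.+ (concurrence · x) j
    a∣y : ∀ j → a ℤ.∣ y j
    a∣y j = ∣-resp (scaled-laplacian x j) (ℤ.∣n⇒∣m*n h (a∣Lx j))
    lem : ∀ f β x b z γ r s →
      (f ℤ.+ β) ℤ.* (f ℤ.* x ℤ.+ b ℤ.+ z) ℤ.- (f ℤ.* z ℤ.+ b ℤ.* (γ ℤ.* r) ℤ.+ (γ ℤ.* γ ℤ.* s ℤ.+ β ℤ.* z)) ≡
      (f ℤ.+ β) ℤ.* f ℤ.* x ℤ.+ ((f ℤ.+ β) ℤ.* b ℤ.- b ℤ.* (γ ℤ.* r) ℤ.- γ ℤ.* γ ℤ.* s)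
    lem = solve-∀
    eq : ∀ i → (f ℤ.+ β) ℤ.* y i ℤ.- (concurrence · y) i ≡
               (f ℤ.+ β) ℤ.* f ℤ.* x i ℤ.+ ((f ℤ.+ β) ℤ.* b ℤ.- b ℤ.* (γ ℤ.* r) ℤ.- γ ℤ.* γ ℤ.* sum x)
    eq i = begin
      (f ℤ.+ β) ℤ.* y i ℤ.- (concurrence · y) i
        ≡⟨ cong (λ z → (f ℤ.+ β) ℤ.* y i ℤ.- z) (·-affine concurrence x (concurrence · x) f b i) ⟩
      (f ℤ.+ β) ℤ.* y i ℤ.- (f ℤ.* (concurrence · x) i ℤ.+ b ℤ.* (concurrence · (λ _ → 1ℤ)) i ℤ.+ (concurrence · concurrence · x) i)
        ≡⟨ cong₂ (λ s t → (f ℤ.+ β) ℤ.* y i ℤ.- (f ℤ.* (concurrence · x) i ℤ.+ b ℤ.* s ℤ.+ t)) (rowSum i) (concurrence² x i) ⟩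
      (f ℤ.+ β) ℤ.* y i ℤ.- (f ℤ.* (concurrence · x) i ℤ.+ b ℤ.* (γ ℤ.* r) ℤ.+ (γ ℤ.* γ ℤ.* sum x ℤ.+ β ℤ.* (concurrence · x) i))
        ≡⟨ lem f β (x i) b ((concurrence · x) i) γ r (sum x) ⟩
      (f ℤ.+ β) ℤ.* f ℤ.* x i ℤ.+ ((f ℤ.+ β) ℤ.* b ℤ.- b ℤ.* (γ ℤ.* r) ℤ.- γ ℤ.* γ ℤ.* sum x) ∎

  module _ {d : Vector ℕ N} (snf : IsSmithNormalForm L d) where

    -- Otherwise `q ^ 4` would divide `(f + β) f = q ^ 3 (q y - 1)`, whose cofactor `q y - 1` is
    -- prime to `q`.
    order⁴∤ : ∀ s → d s ≢ 0 → ¬ (order ^ 4 ∣ d s)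
    order⁴∤ s ds≢0 q⁴∣ds = ℕ.<⇒≱ 1<order (ℕ.∣⇒≤ (∣⇒∣ᵤ q∣1))
      where
      product : ∃[ y ] (f ℤ.+ β) ℤ.* f ≡ q ℤ.* (q ℤ.* (q ℤ.* (q ℤ.* y ℤ.- 1ℤ)))
      product = let y , eq = eigenvalueProduct {q} {q ℤ.^ m} {v′} {r} (geometric-sum q (3 ℕ.+ m)) in
        y , trans (cong (λ z → (h ℤ.* (z ℤ.- q) ℤ.+ β) ℤ.* (h ℤ.* (z ℤ.- q))) k≡) eq
      y : ℤ
      y = proj₁ product
      q⁴∣ : q ℤ.* (q ℤ.* (q ℤ.* q)) ℤ.∣ q ℤ.* (q ℤ.* (q ℤ.* (q ℤ.* y ℤ.- 1ℤ)))
      q⁴∣ = subst (ℤ._∣ q ℤ.* (q ℤ.* (q ℤ.* (q ℤ.* y ℤ.- 1ℤ))))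
        (trans (pos-^ order 4) (cong (λ z → q ℤ.* (q ℤ.* (q ℤ.* z))) (ℤ.*-identityʳ q)))
        (∣-resp (proj₂ product) (ℤ.∣-trans (∣ᵤ⇒∣ {+ (order ^ 4)} {+ d s} q⁴∣ds) (nonzero∣ snf L1≡0 reduce s ds≢0)))
      q∣ : q ℤ.∣ q ℤ.* y ℤ.- 1ℤ
      q∣ = ℤ.*-cancelˡ-∣ q (ℤ.*-cancelˡ-∣ q (ℤ.*-cancelˡ-∣ q q⁴∣))
      lem : ∀ q y → q ℤ.* y ℤ.- (q ℤ.* y ℤ.- 1ℤ) ≡ 1ℤ
      lem = solve-∀
      q∣1 : q ℤ.∣ 1ℤ
      q∣1 = ∣-resp (lem q y) (ℤ.∣m∣n⇒∣m-n (ℤ.∣m⇒∣m*n y ℤ.∣-refl) q∣)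

  module _ {a} (a∣k : a ℤ.∣ k) where

    A-kernel⊆L-kernel : ∀ x → (∀ i → a ℤ.∣ (A · x) i) → ∀ i → a ℤ.∣ (L · x) i
    A-kernel⊆L-kernel x a∣Ax i = ∣-resp (sym (laplacian-· x i))
      (ℤ.∣m∣n⇒∣m-n (ℤ.∣m⇒∣m*n (x i) a∣k) (a∣Ax i))

    L-kernel⊆A-kernel : ∀ x → (∀ i → a ℤ.∣ (L · x) i) → ∀ i → a ℤ.∣ (A · x) i
    L-kernel⊆A-kernel x a∣Lx i = ∣-resp (trans (cong (λ z → k ℤ.* x i ℤ.- z) (laplacian-· x i)) (lem (k ℤ.* x i) ((A · x) i)))
      (ℤ.∣m∣n⇒∣m-n (ℤ.∣m⇒∣m*n (x i) a∣k) (a∣Lx i))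
      where
      lem : ∀ y z → y ℤ.- (y ℤ.- z) ≡ z
      lem = solve-∀

mainTheorem2 : ∀ {c ℓ} (F : FiniteField c ℓ) (p t n : ℕ) →
    Prime p → 1 ≤ t → 4 ≤ n → FiniteField.order F ≡ p ^ t →
    ∀ {N} (vertices : Inverse (Grassmannian F n 2) (setoid (Fin N))) →
    ∀ (dA dL : Vector ℕ N) →
    IsSmithNormalForm (SkewLines.adjacency F n vertices) dA →
    IsSmithNormalForm (SkewLines.laplacian F n vertices) dL →
    ∀ (i : ℕ) →
    (i < 4 * t → multiplicity p i dL ≡ multiplicity p i dA) ×
    (4 * t ≤ i → multiplicity p i dL ≡ 0)
mainTheorem2 F p t (suc (suc (suc (suc m)))) pr _ (ℕ.s≤s (ℕ.s≤s (ℕ.s≤s (ℕ.s≤s ℕ.z≤n)))) order≡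
             vertices dA dL snfA snfL i =
  low , high
  where
  open Laplacian F m vertices
  open FiniteField F using (order)

  order⁴≡ : order ^ 4 ≡ p ^ (4 * t)
  order⁴≡ = trans (cong (_^ 4) order≡) (trans (ℕ.^-*-assoc p t 4) (cong (p ^_) (ℕ.*-comm t 4)))

  ^-mono-∣ : ∀ {j l} → j ≤ l → p ^ j ∣ p ^ l
  ^-mono-∣ {j} {l} j≤l = subst (λ x → p ^ j ∣ p ^ x) (ℕ.m+[n∸m]≡n j≤l)
    (subst (p ^ j ∣_) (sym (ℕ.^-distribˡ-+-* p j (l ℕ.∸ j))) (ℕ.m∣m*n (p ^ (l ℕ.∸ j))))

  ∣k : ∀ {j} → j ≤ 4 * t → + (p ^ j) ℤ.∣ k
  ∣k {j} j≤4t = ∣ᵤ⇒∣ (ℕ.∣m⇒∣m*n (gaussianBinomial F (2 ℕ.+ m) 2)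
    (subst (p ^ j ∣_) (sym order⁴≡) (^-mono-∣ j≤4t)))

  counts≡ : ∀ {j} → j ≤ 4 * t → countMultiples (p ^ j) dL ≡ countMultiples (p ^ j) dA
  counts≡ {j} j≤4t = ℕ.≤-antisym
    (countMultiples-mono pr snfL snfA j (L-kernel⊆A-kernel (∣k j≤4t)))
    (countMultiples-mono pr snfA snfL j (A-kernel⊆L-kernel (∣k j≤4t)))

  low : i < 4 * t → multiplicity p i dL ≡ multiplicity p i dA
  -- A multiplicity is the difference of the counts at `i` and `suc i`. The strict bound is
  -- `suc i ≤ 4 * t`, so both powers of `p` divide the valency.
  low i<4t = ℕ.+-cancelʳ-≡ (countMultiples (p ^ suc i) dA) _ _ (begin
    multiplicity p i dL ℕ.+ countMultiples (p ^ suc i) dA ≡⟨ cong (multiplicity p i dL ℕ.+_) (counts≡ i<4t) ⟨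
    multiplicity p i dL ℕ.+ countMultiples (p ^ suc i) dL ≡⟨ multiplicity+ p i dL ⟩
    countMultiples (p ^ i) dL                             ≡⟨ counts≡ (ℕ.<⇒≤ i<4t) ⟩
    countMultiples (p ^ i) dA                             ≡⟨ multiplicity+ p i dA ⟨
    multiplicity p i dA ℕ.+ countMultiples (p ^ suc i) dA ∎)
    where open ≡-Reasoning

  high : 4 * t ≤ i → multiplicity p i dL ≡ 0
  high 4t≤i = multiplicity≡0 p i dL λ s (ds≢0 , pi∣ds , _) →
    order⁴∤ snfL s ds≢0 (subst (_∣ dL s) (sym order⁴≡) (ℕ.∣-trans (^-mono-∣ 4t≤i) pi∣ds))
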